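{- For the ARMSM$(m,K)$ problem subject to a single knapsack constraint, if the removed items have total cost at most $M$, there exists an algorithm that stores $\tilde{O}(K+M)$ elements and outputs a set $Z\subseteq V\setminus E$ with cost at most $K$ such that $f(Z)$ is a constant factor approximation to $f(\mathcal{OPT}(V\setminus E))$, where $E$ is the set of removed items.
   Context: $V$ is a finite ground set and $f:2^V\to\mathbb R_{\ge 0}$ is monotone and submodular. Each element $e$ has a cost $c(e)\ge 1$, $c(S)=\sum_{e\in S}c(e)$, and $K$ is the knapsack budget. $\mathcal{OPT}(W)$ is a set $S\subseteq W$ with $c(S)\le K$ maximizing $f(S)$. In ARMSM$(m,K)$ the algorithm stores a summary of elements before an adversarially chosen removal set $E$ of at most $m$ elements is revealed; here additionally $c(E)\le M$. $\tilde O(\cdot)$ hides polylogarithmic factors.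
   Formalization: The values of f, the costs c(e), the budget K and the bound M are rational numbers instead of real numbers; the polylogarithmic factor hidden in the storage bound is a power of 1+⌊log₂|V|⌋. -}

module Defs where

open import Data.Nat using (ℕ; zero; suc)
open import Data.Nat.Logarithm using (⌊log₂_⌋)
open import Data.Bool using (true; false)
open import Data.Fin using (Fin)
import Data.Fin as Fin
open import Data.Fin.Subset using (Subset; _⊆_; _∪_; _∩_; ∁; ∣_∣)
open import Data.Vec using ([]; _∷_)
open import Data.Integer using (+_)
open import Data.Rational using (ℚ; 0ℚ; 1ℚ; _+_; _*_; _≤_; _/_)
open import Data.Product using (_×_)

ℕ→ℚ : ℕ → ℚ
ℕ→ℚ k = (+ k) / 1

_^ℚ_ : ℚ → ℕ → ℚ
q ^ℚ zero = 1ℚ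
q ^ℚ suc k = q * (q ^ℚ k)

cost : ∀ {n} → (Fin n → ℚ) → Subset n → ℚ
cost {zero} c [] = 0ℚ
cost {suc n} c (true ∷ s) = c Fin.zero + cost (λ i → c (Fin.suc i)) s
cost {suc n} c (false ∷ s) = cost (λ i → c (Fin.suc i)) s

NonNeg : ∀ {n} → (Subset n → ℚ) → Set
NonNeg {n} f = (S : Subset n) → 0ℚ ≤ f S

Monotone : ∀ {n} → (Subset n → ℚ) → Set
Monotone {n} f = (S T : Subset n) → S ⊆ T → f S ≤ f T

Submodular : ∀ {n} → (Subset n → ℚ) → Set
Submodular {n} f = (S T : Subset n) → f (S ∪ T) + f (S ∩ T) ≤ f S + f T

CostsAtLeastOne : ∀ {n} → (Fin n → ℚ) → Set
CostsAtLeastOne {n} c = (e : Fin n) → 1ℚ ≤ c e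

polylog : ℕ → ℕ → ℚ
polylog n d = ℕ→ℚ (suc ⌊log₂ n ⌋) ^ℚ d

-- Summary algorithm: sees the instance (n, f, c, K, M, m), not E.
SummaryAlg : Set
SummaryAlg = (n : ℕ) → (Subset n → ℚ) → (Fin n → ℚ) → ℚ → ℚ → ℕ → Subset n

-- Output algorithm: sees the instance and the removed set E.
OutputAlg : Set
OutputAlg = (n : ℕ) → (Subset n → ℚ) → (Fin n → ℚ) → ℚ → ℚ → ℕ → Subset n → Subset n

{-# OPTIONS --safe #-}
module Submission where

open import Defs
open import Data.Bool using (true; false; if_then_else_)
open import Data.Nat using (ℕ; zero; suc)
import Data.Nat as ℕ
open import Data.Nat.DivMod using (m≡m%n+[m/n]*n; m%n<n; m/n*n≤m)
open import Data.Nat.Logarithm using (⌊log₂_⌋; ⌊log₂[2^n]⌋≡n; ⌊log₂⌋-mono-≤)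
import Data.Nat.Properties as ℕ
import Data.Nat.Tactic.RingSolver as ℕ-Solver
import Data.Integer as ℤ
import Data.Integer.Properties as ℤ
open import Data.Rational using (ℚ; 0ℚ; 1ℚ; ½; _+_; _*_; _≤_; _<_; toℚᵘ; nonNegative; positive)
open import Data.Rational.Properties
open import Data.Rational.Unnormalised as ℚᵘ using (mkℚᵘ; *≡*)
import Data.Rational.Unnormalised.Properties as ℚᵘ
open import Data.Fin using (Fin; zero; suc)
open import Data.Fin.Subset
open import Data.Fin.Subset.Properties
open import Data.Vec using ([]; _∷_; here; there; tabulate)
open import Data.Vec.Properties using (lookup∘tabulate; []=⇒lookup; lookup⇒[]=)
open import Data.Product using (Σ; ∃; ∃-syntax; _×_; _,_; proj₁; proj₂)
open import Data.Sum using (_⊎_; inj₁; inj₂; [_,_]′)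
open import Function using (_∘_; const)
open import Level using (0ℓ)
open import Relation.Nullary using (Dec; does; ¬_; yes; no; contradiction)
open import Relation.Nullary.Decidable using (_×-dec_; dec⇒maybe; dec-true)
open import Relation.Unary using (Decidable)
open import Relation.Binary.PropositionalEquality
open import Tactic.RingSolver using (solve-∀)
open import Tactic.RingSolver.Core.AlmostCommutativeRing
  using (AlmostCommutativeRing; fromCommutativeRing)

-- Set aside ⌊M⌋ + 1 elements of largest value; one of them survives, with value at least the value Δ
-- of any single remaining element.  From the rest peel off buckets: sets B of density f B / c(B) ≥ ρ,
-- filled up to cost about σ, where ρσ = τ is fixed and σ = 1, 2, 4, …, 2^ℓ with K ≤ 2^ℓ ≤ 2K.  If a
-- bucket fails to fill, everything left over has marginal density at most ρ over it.  A level has so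
-- many buckets that some bucket loses to E cost at most σ / 4(ℓ+1).  The elements of this chosen bucket
-- were rejected by the bucket chosen one level before, whose threshold is 2ρ, so replacing the chosen
-- buckets one after another by their surviving parts costs at most τ/2 in total.  Hence either some
-- chosen bucket is full and the survivors have value at least τ/2, or all of them rejected the
-- discarded elements, which then add at most τ to the optimum.  The survivors cost at most 8K, so they
-- contain an affordable set of proportional value.  One of the scales τ = Δ, 2Δ, 4Δ, … up to KΔ is
-- within a constant factor of the optimum.

-- Rational arithmetic and the embedding of the naturals.

ℚ-ring : AlmostCommutativeRing 0ℓ 0ℓ
ℚ-ring = fromCommutativeRing +-*-commutativeRing (λ x → dec⇒maybe (0ℚ ≟ x))

-- Linear arithmetic: `a ≤ b` is a sum of known inequalities, and the identity `q - p = b - a`,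
-- written without subtraction, is left to the ring solver.
≤-from-sum : ∀ {a b p q} → a ≤ b → p + b ≡ q + a → p ≤ q
≤-from-sum a≤b eq = ≮⇒≥ λ q<p → <-irrefl (sym eq) (+-mono-<-≤ q<p a≤b)

*-monoˡ-≤ : ∀ {r p q} → 0ℚ ≤ r → p ≤ q → r * p ≤ r * q
*-monoˡ-≤ {r} 0≤r = *-monoˡ-≤-nonNeg r {{nonNegative 0≤r}}

*-monoʳ-≤ : ∀ {r p q} → 0ℚ ≤ r → p ≤ q → p * r ≤ q * r
*-monoʳ-≤ {r} 0≤r = *-monoʳ-≤-nonNeg r {{nonNegative 0≤r}}

*-cancelˡ-≤ : ∀ {r p q} → 0ℚ < r → r * p ≤ r * q → p ≤ q
*-cancelˡ-≤ {r} 0<r = *-cancelˡ-≤-pos r {{positive 0<r}}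

*-nonNeg : ∀ {p q} → 0ℚ ≤ p → 0ℚ ≤ q → 0ℚ ≤ p * q
*-nonNeg {p} 0≤p 0≤q = ≤-trans (≤-reflexive (sym (*-zeroʳ p))) (*-monoˡ-≤ 0≤p 0≤q)

p≤p+q : ∀ {p q} → 0ℚ ≤ q → p ≤ p + q
p≤p+q {p} 0≤q = ≤-trans (≤-reflexive (sym (+-identityʳ p))) (+-monoʳ-≤ p 0≤q)

0<1 : 0ℚ < 1ℚ
0<1 = positive⁻¹ 1ℚ

-- `ℕ→ℚ` normalises by a gcd, so its laws are checked on unnormalised rationals, where it is plainly
-- `k` over 1.
toℚᵘ-ℕ→ℚ : ∀ k → toℚᵘ (ℕ→ℚ k) ℚᵘ.≃ mkℚᵘ (ℤ.+ k) 0
toℚᵘ-ℕ→ℚ k = toℚᵘ-fromℚᵘ (mkℚᵘ (ℤ.+ k) 0)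

ℕ→ℚ-+ : ∀ m n → ℕ→ℚ (m ℕ.+ n) ≡ ℕ→ℚ m + ℕ→ℚ n
ℕ→ℚ-+ m n = toℚᵘ-injective (ℚᵘ.≃-trans (toℚᵘ-ℕ→ℚ (m ℕ.+ n)) (ℚᵘ.≃-trans
  (*≡* (cong₂ (λ x y → (x ℤ.+ y) ℤ.* ℤ.+ 1) (sym (ℤ.*-identityʳ (ℤ.+ m))) (sym (ℤ.*-identityʳ (ℤ.+ n)))))
  (ℚᵘ.≃-sym (ℚᵘ.≃-trans (toℚᵘ-homo-+ (ℕ→ℚ m) (ℕ→ℚ n)) (ℚᵘ.+-cong (toℚᵘ-ℕ→ℚ m) (toℚᵘ-ℕ→ℚ n))))))

ℕ→ℚ-* : ∀ m n → ℕ→ℚ (m ℕ.* n) ≡ ℕ→ℚ m * ℕ→ℚ n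
ℕ→ℚ-* m n = toℚᵘ-injective (ℚᵘ.≃-trans (toℚᵘ-ℕ→ℚ (m ℕ.* n)) (ℚᵘ.≃-trans
  (*≡* (cong (ℤ._* ℤ.+ 1) (ℤ.pos-* m n)))
  (ℚᵘ.≃-sym (ℚᵘ.≃-trans (toℚᵘ-homo-* (ℕ→ℚ m) (ℕ→ℚ n)) (ℚᵘ.*-cong (toℚᵘ-ℕ→ℚ m) (toℚᵘ-ℕ→ℚ n))))))

ℕ→ℚ-mono-≤ : ∀ {m n} → m ℕ.≤ n → ℕ→ℚ m ≤ ℕ→ℚ n
ℕ→ℚ-mono-≤ {m} {n} m≤n = toℚᵘ-cancel-≤ (ℚᵘ.≤-respˡ-≃ (ℚᵘ.≃-sym (toℚᵘ-ℕ→ℚ m))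
  (ℚᵘ.≤-respʳ-≃ (ℚᵘ.≃-sym (toℚᵘ-ℕ→ℚ n)) (ℚᵘ.*≤* (ℤ.*-monoʳ-≤-nonNeg (ℤ.+ 1) (ℤ.+≤+ m≤n)))))

ℕ→ℚ-nonNeg : ∀ n → 0ℚ ≤ ℕ→ℚ n
ℕ→ℚ-nonNeg n = ℕ→ℚ-mono-≤ {0} {n} ℕ.z≤n

ℕ→ℚ-suc : ∀ n → ℕ→ℚ (suc n) ≡ 1ℚ + ℕ→ℚ n
ℕ→ℚ-suc = ℕ→ℚ-+ 1

ℕ→ℚ-mono-< : ∀ {m n} → m ℕ.< n → ℕ→ℚ m < ℕ→ℚ n
ℕ→ℚ-mono-< {m} m<n = <-≤-trans
  (subst₂ _<_ (+-identityˡ (ℕ→ℚ m)) (sym (ℕ→ℚ-suc m)) (+-monoˡ-< (ℕ→ℚ m) 0<1))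
  (ℕ→ℚ-mono-≤ {suc m} m<n)

ℕ→ℚ-cancel-≤ : ∀ {m n} → ℕ→ℚ m ≤ ℕ→ℚ n → m ℕ.≤ n
ℕ→ℚ-cancel-≤ {m} {n} m≤n = ℕ.≮⇒≥ λ n<m → <-irrefl refl (<-≤-trans (ℕ→ℚ-mono-< {n} {m} n<m) m≤n)

ℕ→ℚ-pos : ∀ n → 0ℚ < ℕ→ℚ (suc n)
ℕ→ℚ-pos n = ℕ→ℚ-mono-< {0} {suc n} ℕ.z<s

-- Inclusions and cardinalities of finite sets.

module _ {n : ℕ} where

  ∪-elim : ∀ {p q r : Subset n} → p ⊆ r → q ⊆ r → p ∪ q ⊆ r
  ∪-elim {p} {q} p⊆r q⊆r x∈ = [ p⊆r , q⊆r ]′ (x∈p∪q⁻ p q x∈)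

  ∩-intro : ∀ {p q r : Subset n} → r ⊆ p → r ⊆ q → r ⊆ p ∩ q
  ∩-intro r⊆p r⊆q x∈ = x∈p∩q⁺ (r⊆p x∈ , r⊆q x∈)

  ∪ˡ : ∀ {p q r : Subset n} → r ⊆ p → r ⊆ p ∪ q
  ∪ˡ r⊆p x∈ = x∈p∪q⁺ (inj₁ (r⊆p x∈))

  ∪ʳ : ∀ {p q r : Subset n} → r ⊆ q → r ⊆ p ∪ q
  ∪ʳ r⊆q x∈ = x∈p∪q⁺ (inj₂ (r⊆q x∈))

  ∩ˡ : ∀ {p q : Subset n} → p ∩ q ⊆ p
  ∩ˡ {p} {q} = p∩q⊆p p q

  ∩ʳ : ∀ {p q : Subset n} → p ∩ q ⊆ q
  ∩ʳ {p} {q} = p∩q⊆q p q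

  ⁅⁆⊆ : ∀ {x} {p : Subset n} → x ∈ p → ⁅ x ⁆ ⊆ p
  ⁅⁆⊆ {x} {p} x∈p y∈ = subst (_∈ p) (sym (x∈⁅y⁆⇒x≡y x y∈)) x∈p

  split-by : ∀ (q : Subset n) {p} → p ⊆ (p ∩ q) ∪ (p ∩ ∁ q)
  split-by q {p} {x} x∈p with x ∈? q
  ... | yes x∈q = x∈p∪q⁺ (inj₁ (x∈p∩q⁺ (x∈p , x∈q)))
  ... | no  x∉q = x∈p∪q⁺ (inj₂ (x∈p∩q⁺ (x∈p , x∉p⇒x∈∁p x∉q)))

∣p∣≤∣p∩∁q∣+∣q∣ : ∀ {n} (p q : Subset n) → ∣ p ∣ ℕ.≤ ∣ p ∩ ∁ q ∣ ℕ.+ ∣ q ∣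
∣p∣≤∣p∩∁q∣+∣q∣ [] [] = ℕ.z≤n
∣p∣≤∣p∩∁q∣+∣q∣ (true ∷ p) (true ∷ q) = ℕ.≤-trans (ℕ.s≤s (∣p∣≤∣p∩∁q∣+∣q∣ p q)) (ℕ.≤-reflexive (sym (ℕ.+-suc _ _)))
∣p∣≤∣p∩∁q∣+∣q∣ (true ∷ p) (false ∷ q) = ℕ.s≤s (∣p∣≤∣p∩∁q∣+∣q∣ p q)
∣p∣≤∣p∩∁q∣+∣q∣ (false ∷ p) (true ∷ q) = ℕ.≤-trans (∣p∣≤∣p∩∁q∣+∣q∣ p q) (ℕ.+-monoʳ-≤ _ (ℕ.n≤1+n _))
∣p∣≤∣p∩∁q∣+∣q∣ (false ∷ p) (false ∷ q) = ∣p∣≤∣p∩∁q∣+∣q∣ p q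

∣p∩∁q∣+∣q∣≤∣p∣ : ∀ {n} (p q : Subset n) → q ⊆ p → ∣ p ∩ ∁ q ∣ ℕ.+ ∣ q ∣ ℕ.≤ ∣ p ∣
∣p∩∁q∣+∣q∣≤∣p∣ [] [] _ = ℕ.z≤n
∣p∩∁q∣+∣q∣≤∣p∣ (true ∷ p) (true ∷ q) q⊆p = ℕ.≤-trans (ℕ.≤-reflexive (ℕ.+-suc _ _)) (ℕ.s≤s (∣p∩∁q∣+∣q∣≤∣p∣ p q (drop-∷-⊆ q⊆p)))
∣p∩∁q∣+∣q∣≤∣p∣ (true ∷ p) (false ∷ q) q⊆p = ℕ.s≤s (∣p∩∁q∣+∣q∣≤∣p∣ p q (drop-∷-⊆ q⊆p))
∣p∩∁q∣+∣q∣≤∣p∣ (false ∷ p) (true ∷ q) q⊆p = contradiction (q⊆p here) λ ()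
∣p∩∁q∣+∣q∣≤∣p∣ (false ∷ p) (false ∷ q) q⊆p = ∣p∩∁q∣+∣q∣≤∣p∣ p q (drop-∷-⊆ q⊆p)

-- Maximisation by exhaustive search over subsets.

ArgMax : ∀ {A : Set} → (A → ℚ) → (A → Set) → A → Set
ArgMax h P x = P x × (∀ y → P y → h y ≤ h x)

argMax? : ∀ {n} (h : Subset n → ℚ) {P : Subset n → Set} → Decidable P →
          ∃ (ArgMax h P) ⊎ (∀ y → ¬ P y)
argMax? {zero} h P? with P? []
... | yes p = inj₁ ([] , p , λ { [] _ → ≤-refl })
... | no ¬p = inj₂ λ { [] → ¬p }
argMax? {suc n} h P?
  with argMax? (h ∘ (true ∷_)) (P? ∘ (true ∷_)) | argMax? (h ∘ (false ∷_)) (P? ∘ (false ∷_))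
... | inj₂ ¬t | inj₂ ¬f = inj₂ λ { (true ∷ y) → ¬t y ; (false ∷ y) → ¬f y }
... | inj₁ (x , p , x-max) | inj₂ ¬f = inj₁ (true ∷ x , p ,
      λ { (true ∷ y) q → x-max y q ; (false ∷ y) q → contradiction q (¬f y) })
... | inj₂ ¬t | inj₁ (x , p , x-max) = inj₁ (false ∷ x , p ,
      λ { (true ∷ y) q → contradiction q (¬t y) ; (false ∷ y) q → x-max y q })
... | inj₁ (x , p , x-max) | inj₁ (x′ , p′ , x′-max) with ≤-total (h (true ∷ x)) (h (false ∷ x′))
...   | inj₁ le = inj₁ (false ∷ x′ , p′ ,
        λ { (true ∷ y) q → ≤-trans (x-max y q) le ; (false ∷ y) q → x′-max y q })
...   | inj₂ ge = inj₁ (true ∷ x , p ,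
        λ { (true ∷ y) q → x-max y q ; (false ∷ y) q → ≤-trans (x′-max y q) ge })

-- `⊥` is a default for an empty range. In the analysis the empty set is itself a candidate of every
-- search, so `argMax-spec` applies.
argMax : ∀ {n} (h : Subset n → ℚ) {P : Subset n → Set} → Decidable P → Subset n
argMax h P? = [ proj₁ , const ⊥ ]′ (argMax? h P?)

argMax-spec : ∀ {n} (h : Subset n → ℚ) {P : Subset n → Set} (P? : Decidable P) →
              ∃ P → ArgMax h P (argMax h P?)
argMax-spec h P? (y , p) with argMax? h P?
... | inj₁ (_ , spec) = spec
... | inj₂ ¬P = contradiction p (¬P y)

-- Costs of sets and marginal gains.

cost-⊥ : ∀ {n} (c : Fin n → ℚ) → cost c ⊥ ≡ 0ℚ
cost-⊥ {zero} c = refl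
cost-⊥ {suc n} c = cost-⊥ (c ∘ suc)

cost-⁅⁆ : ∀ {n} (c : Fin n → ℚ) e → cost c ⁅ e ⁆ ≡ c e
cost-⁅⁆ c zero = trans (cong (c zero +_) (cost-⊥ (c ∘ suc))) (+-identityʳ _)
cost-⁅⁆ c (suc e) = cost-⁅⁆ (c ∘ suc) e

-- A superset `r` in place of `p ∪ q` saves computing unions and gives monotonicity of the cost at
-- `q = ⊥`.
cost-disjoint : ∀ {n} {c : Fin n → ℚ} → (∀ e → 0ℚ ≤ c e) → (p q r : Subset n) →
                p ⊆ r → q ⊆ r → (∀ {x} → x ∈ p → x ∉ q) → cost c p + cost c q ≤ cost c r
cost-disjoint 0≤c [] [] [] _ _ _ = ≤-refl
cost-disjoint 0≤c (true ∷ p) (true ∷ q) r _ _ disj = contradiction here (disj here)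
cost-disjoint 0≤c (true ∷ p) (false ∷ q) (false ∷ r) p⊆r _ _ = contradiction (p⊆r here) λ ()
cost-disjoint 0≤c (false ∷ p) (true ∷ q) (false ∷ r) _ q⊆r _ = contradiction (q⊆r here) λ ()
cost-disjoint {c = c} 0≤c (true ∷ p) (false ∷ q) (true ∷ r) p⊆r q⊆r disj =
  ≤-trans (≤-reflexive (+-assoc (c zero) _ _))
    (+-monoʳ-≤ (c zero) (cost-disjoint (0≤c ∘ suc) p q r (drop-∷-⊆ p⊆r) (drop-∷-⊆ q⊆r)
      λ x∈p x∈q → disj (there x∈p) (there x∈q)))
cost-disjoint {c = c} 0≤c (false ∷ p) (true ∷ q) (true ∷ r) p⊆r q⊆r disj =
  ≤-trans (≤-reflexive (lemma (c zero) (cost (c ∘ suc) p) (cost (c ∘ suc) q)))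
    (+-monoʳ-≤ (c zero) (cost-disjoint (0≤c ∘ suc) p q r (drop-∷-⊆ p⊆r) (drop-∷-⊆ q⊆r)
      λ x∈p x∈q → disj (there x∈p) (there x∈q)))
  where lemma : ∀ x y z → y + (x + z) ≡ x + (y + z)
        lemma = solve-∀ ℚ-ring
cost-disjoint {c = c} 0≤c (false ∷ p) (false ∷ q) (s ∷ r) p⊆r q⊆r disj =
  ≤-trans (cost-disjoint (0≤c ∘ suc) p q r (drop-∷-⊆ p⊆r) (drop-∷-⊆ q⊆r)
      λ x∈p x∈q → disj (there x∈p) (there x∈q)) (drop s)
  where drop : ∀ s → cost (c ∘ suc) r ≤ cost c (s ∷ r)
        drop true = ≤-trans (p≤p+q (0≤c zero)) (≤-reflexive (+-comm _ (c zero)))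
        drop false = ≤-refl

cost-mono : ∀ {n} {c : Fin n → ℚ} → (∀ e → 0ℚ ≤ c e) → {p q : Subset n} →
            p ⊆ q → cost c p ≤ cost c q
cost-mono {c = c} 0≤c {p} {q} p⊆q = ≤-trans
  (≤-reflexive (trans (sym (+-identityʳ _)) (cong (cost c p +_) (sym (cost-⊥ c)))))
  (cost-disjoint 0≤c p ⊥ q p⊆q ⊥⊆ λ _ → ∉⊥)

cost-∪ : ∀ {n} {c : Fin n → ℚ} → (∀ e → 0ℚ ≤ c e) → (p q : Subset n) →
         cost c (p ∪ q) ≤ cost c p + cost c q
cost-∪ 0≤c [] [] = ≤-refl
cost-∪ {c = c} 0≤c (true ∷ p) (true ∷ q) = ≤-trans (+-monoʳ-≤ (c zero) (cost-∪ (0≤c ∘ suc) p q))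
  (≤-trans (p≤p+q (0≤c zero)) (≤-reflexive (lemma (c zero) (cost (c ∘ suc) p) (cost (c ∘ suc) q))))
  where lemma : ∀ x y z → x + (y + z) + x ≡ x + y + (x + z)
        lemma = solve-∀ ℚ-ring
cost-∪ {c = c} 0≤c (true ∷ p) (false ∷ q) = ≤-trans (+-monoʳ-≤ (c zero) (cost-∪ (0≤c ∘ suc) p q))
  (≤-reflexive (sym (+-assoc (c zero) _ _)))
cost-∪ {c = c} 0≤c (false ∷ p) (true ∷ q) = ≤-trans (+-monoʳ-≤ (c zero) (cost-∪ (0≤c ∘ suc) p q))
  (≤-reflexive (lemma (c zero) (cost (c ∘ suc) p) (cost (c ∘ suc) q)))
  where lemma : ∀ x y z → x + (y + z) ≡ y + (x + z)
        lemma = solve-∀ ℚ-ring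
cost-∪ 0≤c (false ∷ p) (false ∷ q) = cost-∪ (0≤c ∘ suc) p q

∣p∣≤cost : ∀ {n} {c : Fin n → ℚ} → CostsAtLeastOne c → (p : Subset n) → ℕ→ℚ ∣ p ∣ ≤ cost c p
∣p∣≤cost 1≤c [] = ≤-refl
∣p∣≤cost 1≤c (true ∷ p) = ≤-trans (≤-reflexive (ℕ→ℚ-suc ∣ p ∣))
  (+-mono-≤ (1≤c zero) (∣p∣≤cost (1≤c ∘ suc) p))
∣p∣≤cost 1≤c (false ∷ p) = ∣p∣≤cost (1≤c ∘ suc) p

-- Induction on the ground set: fixing the first coordinate to `false` keeps `g` monotone and
-- submodular, and submodularity for `⁅ zero ⁆` and the rest of `R` adds the gain of the first
-- element. The uses of `mono` on it replace the equations `⊥ ∪ R = R` and `⊥ ∩ R = ⊥`.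
marginals : ∀ {n} {g : Subset n → ℚ} {c : Fin n → ℚ} {ρ} → Monotone g → Submodular g →
  (R : Subset n) → (∀ {e} → e ∈ R → g ⁅ e ⁆ ≤ g ⊥ + ρ * c e) → g R ≤ g ⊥ + ρ * cost c R
marginals {g = g} {ρ = ρ} mono sub [] _ = p≤p+q (≤-reflexive (sym (*-zeroʳ ρ)))
marginals {ρ = ρ} mono sub (false ∷ R) small =
  marginals {ρ = ρ} (λ S T S⊆T → mono _ _ (out⊆ S⊆T)) (λ S T → sub _ _) R (small ∘ there)
marginals {g = g} {c} {ρ} mono sub (true ∷ R) small = ≤-from-sum
  (+-mono-≤ (small here) (+-mono-≤
    (marginals {g = g ∘ (false ∷_)} {c ∘ suc} {ρ} (λ S T S⊆T → mono _ _ (out⊆ S⊆T)) (λ S T → sub _ _) R (small ∘ there))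
    (≤-trans (+-mono-≤ (mono _ _ (in⊆in {q = ⊥ ∪ R} (q⊆p∪q ⊥ R))) (mono (false ∷ ⊥) (false ∷ (⊥ ∩ R)) (out⊆ ⊥⊆)))
             (sub (true ∷ ⊥) (false ∷ R)))))
  (lemma (g (true ∷ R)) (g ⊥) ρ (c zero) (cost (c ∘ suc) R) (g (true ∷ ⊥)) (g (false ∷ R)))
  where
  lemma : ∀ x z r a b u w → x + ((z + r * a) + ((z + r * b) + (u + w))) ≡ (z + r * (a + b)) + (u + (w + (x + z)))
  lemma = solve-∀ ℚ-ring

-- Opaque because unification would otherwise normalise the gcd inside ℕ→ℚ (2 ^ suc k).
opaque
  pow : ℕ → ℚ
  pow k = ℕ→ℚ (2 ℕ.^ k)

  pow-def : ∀ k → pow k ≡ ℕ→ℚ (2 ℕ.^ k)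
  pow-def k = refl

  pow-suc : ∀ k → pow (suc k) ≡ pow k + pow k
  pow-suc k = trans (cong ℕ→ℚ (cong (2 ℕ.^ k ℕ.+_) (ℕ.+-identityʳ _))) (ℕ→ℚ-+ (2 ℕ.^ k) (2 ℕ.^ k))

  pow-mono : ∀ {j k} → j ℕ.≤ k → pow j ≤ pow k
  pow-mono {j} {k} j≤k = ℕ→ℚ-mono-≤ {2 ℕ.^ j} {2 ℕ.^ k} (ℕ.^-monoʳ-≤ 2 j≤k)

  pow-nonNeg : ∀ k → 0ℚ ≤ pow k
  pow-nonNeg k = ℕ→ℚ-nonNeg (2 ℕ.^ k)

-- Peeling off buckets, and the bucket that loses least.

peel : ∀ {n} → (Subset n → Subset n) → ℕ → Subset n → Subset n
peel b zero U = U
peel b (suc N) U = peel b N (U ∩ ∁ (b U))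

module _ {n} {b : Subset n → Subset n} where

  peel-⊆ : ∀ N U → peel b N U ⊆ U
  peel-⊆ zero U = ⊆-refl
  peel-⊆ (suc N) U = ⊆-trans (peel-⊆ N _) ∩ˡ

  peel-size : ∀ {s} → (∀ U → ∣ b U ∣ ℕ.≤ s) → ∀ N U → ∣ U ∣ ℕ.≤ ∣ peel b N U ∣ ℕ.+ N ℕ.* s
  peel-size b≤s zero U = ℕ.≤-reflexive (sym (ℕ.+-identityʳ _))
  peel-size {s} b≤s (suc N) U = begin
    ∣ U ∣                                                ≤⟨ ∣p∣≤∣p∩∁q∣+∣q∣ U (b U) ⟩
    ∣ U ∩ ∁ (b U) ∣ ℕ.+ ∣ b U ∣                          ≤⟨ ℕ.+-mono-≤ (peel-size b≤s N _) (b≤s U) ⟩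
    ∣ peel b N (U ∩ ∁ (b U)) ∣ ℕ.+ N ℕ.* s ℕ.+ s         ≡⟨ ℕ.+-assoc ∣ peel b N (U ∩ ∁ (b U)) ∣ (N ℕ.* s) s ⟩
    ∣ peel b N (U ∩ ∁ (b U)) ∣ ℕ.+ (N ℕ.* s ℕ.+ s)       ≡⟨ cong (∣ peel b N (U ∩ ∁ (b U)) ∣ ℕ.+_) (ℕ.+-comm (N ℕ.* s) s) ⟩
    ∣ peel b N (U ∩ ∁ (b U)) ∣ ℕ.+ (s ℕ.+ N ℕ.* s)       ∎
    where open ℕ.≤-Reasoning

  -- The buckets are disjoint parts of `U`, so one of them loses at most the average share to `E`.
  -- `U′` is what was present when it was formed; all that remains after the peeling lies in `U′`
  -- outside this bucket, hence can be rejected by it.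
  peel-pigeonhole : ∀ {c} → (∀ e → 0ℚ ≤ c e) → (∀ U → b U ⊆ U) → ∀ E N U → ∃ λ U′ →
    U′ ⊆ U × peel b (suc N) U ⊆ U′ ∩ ∁ (b U′) ×
    ℕ→ℚ (suc N) * cost c (E ∩ b U′) ≤ cost c (E ∩ U)
  peel-pigeonhole 0≤c b⊆ E zero U = U , ⊆-refl , ⊆-refl ,
    ≤-trans (≤-reflexive (*-identityˡ _)) (cost-mono 0≤c (∩-intro ∩ˡ (⊆-trans ∩ʳ (b⊆ U))))
  peel-pigeonhole {c} 0≤c b⊆ E (suc N) U
    with ℕ→ℚ (suc (suc N)) * cost c (E ∩ b U) ≤? cost c (E ∩ U)
  ... | yes light = U , ⊆-refl , peel-⊆ (suc N) _ , light
  ... | no heavy with peel-pigeonhole 0≤c b⊆ E N (U ∩ ∁ (b U))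
  ...   | U′ , U′⊆ , peel⊆ , light = U′ , ⊆-trans U′⊆ ∩ˡ , peel⊆ ,
          subst (λ t → t * cost c (E ∩ b U′) ≤ cost c (E ∩ U)) (sym (ℕ→ℚ-suc (suc N)))
            (average (ℕ→ℚ-pos N) light
              (cost-disjoint 0≤c (E ∩ b U) (E ∩ (U ∩ ∁ (b U))) (E ∩ U)
                (∩-intro ∩ˡ (⊆-trans ∩ʳ (b⊆ U))) (∩-intro ∩ˡ (⊆-trans ∩ʳ ∩ˡ))
                λ x∈p x∈q → x∈∁p⇒x∉p (∩ʳ {p = U} (∩ʳ {p = E} x∈q)) (∩ʳ {p = E} x∈p))
              (subst (λ t → cost c (E ∩ U) ≤ t * cost c (E ∩ b U)) (ℕ→ℚ-suc (suc N)) (<⇒≤ (≰⇒> heavy))))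
    where
    -- If the first of `1 + t` buckets takes at least its share of `u`, the others have at most `t`
    -- shares among them, so one within the average of `r` is within the average of `u`.
    average : ∀ {t x y r u} → 0ℚ < t → t * y ≤ r → x + r ≤ u → u ≤ (1ℚ + t) * x → (1ℚ + t) * y ≤ u
    average {t} {x} {y} {r} {u} 0<t ty≤r x+r≤u u≤ = *-cancelˡ-≤ 0<t (≤-from-sum
      (+-mono-≤ (*-monoˡ-≤ 0≤1+t ty≤r) (+-mono-≤ (*-monoˡ-≤ 0≤1+t x+r≤u) u≤)) (eq t x y r u))
      where
      0≤1+t : 0ℚ ≤ 1ℚ + t
      0≤1+t = ≤-trans (<⇒≤ 0<t) (≤-trans (p≤p+q (<⇒≤ 0<1)) (≤-reflexive (+-comm t 1ℚ)))
      eq : ∀ t x y r u → t * ((1ℚ + t) * y) + ((1ℚ + t) * r + ((1ℚ + t) * u + (1ℚ + t) * x))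
                       ≡ t * u + ((1ℚ + t) * (t * y) + ((1ℚ + t) * (x + r) + u))
      eq = solve-∀ ℚ-ring

-- Buckets, levels, scales and the stored set.

module Algorithm {n} (f : Subset n → ℚ) (c : Fin n → ℚ) (K : ℚ) where

  FeasibleIn : Subset n → Subset n → Set
  FeasibleIn T Z = Z ⊆ T × cost c Z ≤ K

  feasibleIn? : ∀ T → Decidable (FeasibleIn T)
  feasibleIn? T Z = (Z ⊆? T) ×-dec (cost c Z ≤? K)

  -- Size at most one, rather than exactly one, keeps `⊥` a candidate when `U` is exhausted.
  TopCandidate : Subset n → Subset n → Set
  TopCandidate U B = FeasibleIn U B × ∣ B ∣ ℕ.≤ 1

  topCandidate? : ∀ U → Decidable (TopCandidate U)
  topCandidate? U B = feasibleIn? U B ×-dec (∣ B ∣ ℕ.≤? 1)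

  top : Subset n → Subset n
  top U = argMax f (topCandidate? U)

  -- A bucket stops at cost σ; the doubled bound leaves room for the element that fills it.
  Dense : ℚ → ℚ → Subset n → Subset n → Set
  Dense σ ρ U B = B ⊆ U × cost c B ≤ σ + σ × ρ * cost c B ≤ f B

  dense? : ∀ σ ρ U → Decidable (Dense σ ρ U)
  dense? σ ρ U B = (B ⊆? U) ×-dec (cost c B ≤? σ + σ) ×-dec (ρ * cost c B ≤? f B)

  -- Maximal cost among dense sets replaces greedy filling: a further element keeping the set dense
  -- would make it costlier.
  bucket : ℚ → ℚ → Subset n → Subset n
  bucket σ ρ U = argMax (cost c) (dense? σ ρ U)

  -- Inversely proportional to the bucket size: with the one bucket added in `levels`, level `k`
  -- costs at most `2 (q + 2 ^ k)`.
  width : ℕ → ℕ → ℕ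
  width q k = ℕ._/_ q (2 ℕ.^ k) {{ℕ.m^n≢0 2 k}}

  levels : ℕ → ℕ → ℕ → ℚ → Subset n → Subset n
  levels q zero k ρ U = U
  levels q (suc r) k ρ U =
    levels q r (suc k) (½ * ρ) (peel (bucket (pow k) ρ) (suc (width q k)) U)

  scales : ℕ → ℕ → ℕ → ℚ → Subset n → Subset n
  scales q ℓ zero τ U = U
  scales q ℓ (suc r) τ U = scales q ℓ r (τ + τ) (levels q (suc ℓ) 0 τ U)

  cheap : Subset n
  cheap = tabulate λ e → does (c e ≤? K)

  afterTop : ℕ → Subset n
  afterTop a = peel top a cheap

  leftover : ℕ → ℕ → Subset n
  leftover a ℓ = scales (4 ℕ.* suc ℓ ℕ.* a) ℓ ℓ (f (top (afterTop a))) (afterTop a)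

  stored : ℕ → ℕ → Subset n
  stored a ℓ = cheap ∩ ∁ (leftover a ℓ)

  levels-⊆ : ∀ q r k ρ U → levels q r k ρ U ⊆ U
  levels-⊆ q zero k ρ U = ⊆-refl
  levels-⊆ q (suc r) k ρ U = ⊆-trans (levels-⊆ q r (suc k) (½ * ρ) _) (peel-⊆ (suc (width q k)) U)

  scales-⊆ : ∀ q ℓ r τ U → scales q ℓ r τ U ⊆ U
  scales-⊆ q ℓ zero τ U = ⊆-refl
  scales-⊆ q ℓ (suc r) τ U = ⊆-trans (scales-⊆ q ℓ r (τ + τ) _) (levels-⊆ q (suc ℓ) 0 τ U)

-- Consequences of submodularity and of maximal choices.

module Analysis {n} {f : Subset n → ℚ} {c : Fin n → ℚ} {K : ℚ}
  (f-nonNeg : NonNeg f) (f-mono : Monotone f) (f-sub : Submodular f)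
  (1≤c : CostsAtLeastOne c) (0≤K : 0ℚ ≤ K) where

  open Algorithm f c K

  0≤c : ∀ e → 0ℚ ≤ c e
  0≤c e = ≤-trans (<⇒≤ 0<1) (1≤c e)

  cost-⊥≤ : ∀ {q} → 0ℚ ≤ q → cost c ⊥ ≤ q
  cost-⊥≤ 0≤q = ≤-trans (≤-reflexive (cost-⊥ c)) 0≤q

  0≤cost : ∀ p → 0ℚ ≤ cost c p
  0≤cost p = ≤-trans (≤-reflexive (sym (cost-⊥ c))) (cost-mono 0≤c ⊥⊆)

  c≤cost : ∀ {e p} → e ∈ p → c e ≤ cost c p
  c≤cost {e} e∈p = ≤-trans (≤-reflexive (sym (cost-⁅⁆ c e))) (cost-mono 0≤c (⁅⁆⊆ e∈p))

  cost<1⇒∉ : ∀ {p} → cost c p < 1ℚ → ∀ {e} → e ∉ p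
  cost<1⇒∉ cost<1 {e} e∈p = <-irrefl refl (≤-<-trans (1≤c e) (≤-<-trans (c≤cost e∈p) cost<1))

  -- With monotonicity built in, unions and intersections need to be known only up to inclusion.
  f-sub′ : ∀ {U I S T} → U ⊆ S ∪ T → I ⊆ S ∩ T → f U + f I ≤ f S + f T
  f-sub′ U⊆ I⊆ = ≤-trans (+-mono-≤ (f-mono _ _ U⊆) (f-mono _ _ I⊆)) (f-sub _ _)

  cost-grows : ∀ {B e} → e ∉ B → cost c B < cost c (B ∪ ⁅ e ⁆)
  cost-grows {B} {e} e∉B = <-≤-trans
    (subst (_< cost c B + cost c ⁅ e ⁆) (+-identityʳ (cost c B))
      (+-monoʳ-< (cost c B) (<-≤-trans 0<1 (≤-trans (1≤c e) (≤-reflexive (sym (cost-⁅⁆ c e)))))))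
    (cost-disjoint 0≤c B ⁅ e ⁆ (B ∪ ⁅ e ⁆) (∪ˡ ⊆-refl) (∪ʳ ⊆-refl)
      λ x∈B x∈e → e∉B (subst (_∈ B) (x∈⁅y⁆⇒x≡y e x∈e) x∈B))

  f-subadditive : ∀ {U S T} → U ⊆ S ∪ T → f U ≤ f S + f T
  f-subadditive {U} U⊆ = ≤-trans (p≤p+q (f-nonNeg ⊥)) (f-sub′ U⊆ ⊥⊆)

  -- Diminishing returns: `marginals` for `f (B ∪ S)` as a function of `S` bounds the gain of `R`
  -- over `B`, and submodularity for `Y` and `B ∪ R` carries the bound to the larger set `Y`.
  f-marginals : ∀ {B R Y W ρ} → (∀ {e} → e ∈ R → f (B ∪ ⁅ e ⁆) ≤ f B + ρ * c e) →
    B ⊆ Y → W ⊆ Y ∪ R → f W ≤ f Y + ρ * cost c R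
  f-marginals {B} {R} {Y} {W} {ρ} small B⊆Y W⊆ = ≤-from-sum
    (+-mono-≤ (f-sub′ {W} {B} {Y} {B ∪ R}
        (⊆-trans W⊆ (∪-elim (∪ˡ ⊆-refl) (∪ʳ (∪ʳ ⊆-refl)))) (∩-intro B⊆Y (∪ˡ ⊆-refl)))
      (+-mono-≤
        (marginals {g = λ S → f (B ∪ S)} {c} {ρ}
          (λ S T S⊆T → f-mono _ _ (∪-elim (∪ˡ ⊆-refl) (∪ʳ S⊆T)))
          (λ S T → f-sub′ {S = B ∪ S} {B ∪ T}
            (∪-elim (∪ˡ (∪ˡ ⊆-refl)) (∪-elim (∪ˡ (∪ʳ ⊆-refl)) (∪ʳ (∪ʳ ⊆-refl))))
            (∩-intro (∪-elim (∪ˡ ⊆-refl) (∪ʳ ∩ˡ)) (∪-elim (∪ˡ ⊆-refl) (∪ʳ ∩ʳ))))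
          R λ e∈R → ≤-trans (small e∈R) (+-monoˡ-≤ _ (f-mono B (B ∪ ⊥) (∪ˡ ⊆-refl))))
        (f-mono (B ∪ ⊥) B (∪-elim ⊆-refl ⊥⊆))))
    (eq (f W) (f Y) (ρ * cost c R) (f B) (f (B ∪ R)) (f (B ∪ ⊥)))
    where
    eq : ∀ w y t b d z → w + ((y + d) + ((z + t) + b)) ≡ (y + t) + ((w + b) + (d + z))
    eq = solve-∀ ℚ-ring

  cheap⇒≤K : ∀ {e} → e ∈ cheap → c e ≤ K
  cheap⇒≤K {e} e∈ = does⇒ (c e ≤? K) (trans (sym (lookup∘tabulate _ e)) ([]=⇒lookup e∈))
    where
    does⇒ : ∀ {A : Set} (a? : Dec A) → does a? ≡ true → A
    does⇒ (yes a) _ = a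

  ≤K⇒cheap : ∀ {e} → c e ≤ K → e ∈ cheap
  ≤K⇒cheap {e} ce≤K = lookup⇒[]= e cheap (trans (lookup∘tabulate _ e) (dec-true (c e ≤? K) ce≤K))

  top-spec : ∀ U → ArgMax f (TopCandidate U) (top U)
  top-spec U = argMax-spec f (topCandidate? U)
    (⊥ , (⊥⊆ , cost-⊥≤ 0≤K) , ℕ.≤-trans (ℕ.≤-reflexive (∣⊥∣≡0 n)) ℕ.z≤n)

  bucket-spec : ∀ {σ} ρ → 0ℚ ≤ σ → ∀ U → ArgMax (cost c) (Dense σ ρ U) (bucket σ ρ U)
  bucket-spec {σ} ρ 0≤σ U = argMax-spec (cost c) (dense? σ ρ U)
    (⊥ , ⊥⊆ , cost-⊥≤ (≤-trans 0≤σ (p≤p+q 0≤σ)) ,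
     ≤-trans (≤-reflexive (trans (cong (ρ *_) (cost-⊥ c)) (*-zeroʳ ρ))) (f-nonNeg ⊥))

  -- A larger gain would make `B ∪ ⁅ e ⁆` dense and costlier than the bucket. It would force
  -- `c e ≤ σ`, since otherwise `f ⁅ e ⁆ ≤ ρ * σ` already bounds the gain by `ρ * c e`; so the
  -- enlarged bucket still costs at most `σ + σ`.
  bucket-maximal : ∀ {σ ρ U e} → 0ℚ ≤ σ → 0ℚ ≤ ρ → cost c (bucket σ ρ U) < σ → e ∈ U → f ⁅ e ⁆ ≤ ρ * σ →
    f (bucket σ ρ U ∪ ⁅ e ⁆) ≤ f (bucket σ ρ U) + ρ * c e
  bucket-maximal {σ} {ρ} {U} {e} 0≤σ 0≤ρ cost<σ e∈U fe≤ρσ = ≮⇒≥ λ gain → absurd gain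
    where
    B = bucket σ ρ U
    B-spec = bucket-spec ρ 0≤σ U
    absurd : ¬ (f B + ρ * c e < f (B ∪ ⁅ e ⁆))
    absurd gain = <-irrefl refl (<-≤-trans (cost-grows e∉B) (proj₂ B-spec (B ∪ ⁅ e ⁆) Be-dense))
      where
      e∉B : e ∉ B
      e∉B e∈B = <-irrefl refl (<-≤-trans gain
        (≤-trans (f-mono _ _ (∪-elim ⊆-refl (⁅⁆⊆ e∈B))) (p≤p+q (*-nonNeg 0≤ρ (0≤c e)))))
      ce≤σ : c e ≤ σ
      ce≤σ = ≮⇒≥ λ σ<ce → <-irrefl refl (<-≤-trans gain
        (≤-trans (f-subadditive {S = B} {⁅ e ⁆} ⊆-refl)
          (+-monoʳ-≤ (f B) (≤-trans fe≤ρσ (*-monoˡ-≤ 0≤ρ (<⇒≤ σ<ce))))))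
      cost-Be≤ : cost c (B ∪ ⁅ e ⁆) ≤ cost c B + c e
      cost-Be≤ = ≤-trans (cost-∪ 0≤c B ⁅ e ⁆) (≤-reflexive (cong (cost c B +_) (cost-⁅⁆ c e)))
      Be-dense : Dense σ ρ U (B ∪ ⁅ e ⁆)
      Be-dense = ∪-elim (proj₁ (proj₁ B-spec)) (⁅⁆⊆ e∈U)
        , ≤-trans cost-Be≤ (+-mono-≤ (<⇒≤ cost<σ) ce≤σ)
        , ≤-trans (*-monoˡ-≤ 0≤ρ cost-Be≤) (≤-trans (≤-reflexive (*-distribˡ-+ ρ (cost c B) (c e)))
            (≤-trans (+-monoˡ-≤ (ρ * c e) (proj₂ (proj₂ (proj₁ B-spec)))) (<⇒≤ gain)))
  affordable : Subset n → Subset n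
  affordable X = argMax (cost c) (feasibleIn? X)

  affordable-spec : ∀ X → ArgMax (cost c) (FeasibleIn X) (affordable X)
  affordable-spec X = argMax-spec (cost c) (feasibleIn? X) (⊥ , ⊥⊆ , cost-⊥≤ 0≤K)

  -- Cut X greedily: a maximal affordable part together with one further element costs more than K.
  f-split : ∀ {v} r X → (∀ Z → FeasibleIn X Z → f Z ≤ v) → X ⊆ cheap →
    cost c X ≤ ℕ→ℚ r * K → f X ≤ ℕ→ℚ (suc (r ℕ.+ r)) * v
  -- Each round removes cost at least `K` and pays `v` twice, for `P` and for `⁅ e ⁆`. Here nothing
  -- costly is left and `X` is itself affordable, which gives the 1 in `1 + 2r`.
  f-split {v} zero X bound X⊆ cost≤ = ≤-trans
    (bound X (⊆-refl , ≤-trans cost≤ (≤-trans (≤-reflexive (*-zeroˡ K)) 0≤K))) (≤-reflexive (sym (*-identityˡ v)))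
  f-split {v} (suc r) X bound X⊆ cost≤ with nonempty? (X ∩ ∁ (affordable X))
  ... | no empty = ≤-trans (f-mono X P X⊆P) (≤-trans v-bound v≤)
    where
    P = affordable X
    v-bound : f P ≤ v
    v-bound = bound P (proj₁ (affordable-spec X))
    X⊆P : X ⊆ P
    X⊆P {x} x∈X with x ∈? P
    ... | yes x∈P = x∈P
    ... | no x∉P = contradiction (x , x∈p∩q⁺ (x∈X , x∉p⇒x∈∁p x∉P)) empty
    v≤ : v ≤ ℕ→ℚ (suc (suc r ℕ.+ suc r)) * v
    v≤ = ≤-trans (≤-reflexive (sym (*-identityˡ v)))
      (*-monoʳ-≤ (≤-trans (f-nonNeg P) v-bound) (ℕ→ℚ-mono-≤ {1} {suc (suc r ℕ.+ suc r)} (ℕ.s≤s ℕ.z≤n)))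
  ... | yes (e , e∈) = ≤-trans
      (f-subadditive {S = P ∪ ⁅ e ⁆} {X′} (⊆-trans (split-by (P ∪ ⁅ e ⁆)) (∪-elim (∪ˡ ∩ʳ) (∪ʳ ⊆-refl))))
      (≤-trans (+-mono-≤
        (≤-trans (f-subadditive {S = P} {⁅ e ⁆} ⊆-refl) (+-mono-≤ (bound P (proj₁ P-spec))
          (bound ⁅ e ⁆ (⁅⁆⊆ e∈X , ≤-trans (≤-reflexive (cost-⁅⁆ c e)) (cheap⇒≤K (X⊆ e∈X))))))
        (f-split r X′ (λ Z (Z⊆ , Z≤) → bound Z (⊆-trans Z⊆ ∩ˡ , Z≤)) (⊆-trans ∩ˡ X⊆) cost-X′≤))
      (≤-reflexive (trans (eq v (ℕ→ℚ (suc (r ℕ.+ r))))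
        (cong (_* v) (sym (trans (cong (λ k → ℕ→ℚ (suc (suc k))) (ℕ.+-suc r r)) (ℕ→ℚ-+ 2 (suc (r ℕ.+ r)))))))))
    where
    P = affordable X
    P-spec = affordable-spec X
    X′ = X ∩ ∁ (P ∪ ⁅ e ⁆)
    e∈X : e ∈ X
    e∈X = ∩ˡ e∈
    Pe⊆X : P ∪ ⁅ e ⁆ ⊆ X
    Pe⊆X = ∪-elim (proj₁ (proj₁ P-spec)) (⁅⁆⊆ e∈X)
    K≤Pe : K ≤ cost c (P ∪ ⁅ e ⁆)
    K≤Pe = ≮⇒≥ λ Pe<K → <-irrefl refl (<-≤-trans
      (cost-grows (x∈∁p⇒x∉p (∩ʳ {p = X} e∈)))
      (proj₂ P-spec (P ∪ ⁅ e ⁆) (Pe⊆X , <⇒≤ Pe<K)))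
    cost-X′≤ : cost c X′ ≤ ℕ→ℚ r * K
    cost-X′≤ = ≤-from-sum (+-mono-≤ K≤Pe (+-mono-≤
      (cost-disjoint 0≤c (P ∪ ⁅ e ⁆) X′ X Pe⊆X ∩ˡ λ x∈ x∈′ → x∈∁p⇒x∉p (∩ʳ {p = X} x∈′) x∈)
      (≤-trans cost≤ (≤-reflexive (cong (_* K) (ℕ→ℚ-suc r))))))
      (eq′ (cost c X′) (ℕ→ℚ r) K (cost c (P ∪ ⁅ e ⁆)) (cost c X))
      where
      eq′ : ∀ x r k p y → x + (p + (y + (1ℚ + r) * k)) ≡ r * k + (k + ((p + x) + y))
      eq′ = solve-∀ ℚ-ring
    eq : ∀ v s → v + v + s * v ≡ (ℕ→ℚ 2 + s) * v
    eq = solve-∀ ℚ-ring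

-- Survivors of the chosen buckets, level by level and scale by scale.

module Recovery {n} {f : Subset n → ℚ} {c : Fin n → ℚ} {K : ℚ}
  (f-nonNeg : NonNeg f) (f-mono : Monotone f) (f-sub : Submodular f)
  (1≤c : CostsAtLeastOne c) (0≤K : 0ℚ ≤ K)
  (a ℓ : ℕ) (K≤ : K ≤ pow ℓ) (≤2K : pow ℓ ≤ K + K)
  {E T : Subset n} {v : ℚ} (cost-E : cost c E < ℕ→ℚ a)
  (T⊆cheap : T ⊆ Algorithm.cheap f c K)
  (bound : ∀ Z → Algorithm.FeasibleIn f c K (T ∩ ∁ E) Z → f Z ≤ v)
  {s : ℚ} (17v≤s : ℕ→ℚ 17 * v ≤ s) where

  open Algorithm f c K
  open Analysis f-nonNeg f-mono f-sub 1≤c 0≤K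

  q w : ℕ
  w = 4 ℕ.* suc ℓ
  q = w ℕ.* a

  0<a : 0ℚ < ℕ→ℚ a
  0<a = ≤-<-trans (0≤cost E) cost-E

  -- `pow (ℓ + 2)` is four times `pow ℓ`, hence at most `8 K`; eight rounds of `f-split` give the
  -- factor `1 + 2 * 8 = 17`.
  f-survivors : ∀ {X} → X ⊆ T ∩ ∁ E → cost c X ≤ pow (suc (suc ℓ)) → f X ≤ s
  f-survivors {X} X⊆ cost≤ = ≤-trans (f-split 8 X (λ Z (Z⊆ , Z≤) → bound Z (⊆-trans Z⊆ X⊆ , Z≤))
    (⊆-trans X⊆ (⊆-trans ∩ˡ T⊆cheap))
    (≤-trans cost≤ (≤-trans (≤-reflexive (trans (pow-suc (suc ℓ)) (cong (λ p → p + p) (pow-suc ℓ))))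
      (≤-from-sum (+-mono-≤ ≤2K (+-mono-≤ ≤2K (+-mono-≤ ≤2K ≤2K))) (eq (pow ℓ) K))))) 17v≤s
    where
    eq : ∀ p k → p + p + (p + p) + (k + k + (k + k + (k + k + (k + k)))) ≡ ℕ→ℚ 8 * k + (p + (p + (p + p)))
    eq = solve-∀ ℚ-ring

  -- B is the bucket chosen on the last level, X the survivors of all chosen buckets, and Λ the loss of
  -- passing from B to X; ρ is the density of the next level, hence half of that of B.
  record Chain (τ ρ Λ : ℚ) (k : ℕ) (B X : Subset n) : Set where
    field
      transfer : ∀ Y → f (Y ∪ B) ≤ f (Y ∪ X) + Λ
      survives : X ⊆ T ∩ ∁ E
      cost-X   : cost c X ≤ pow (suc k)
      loss     : ℕ→ℚ w * Λ ≤ ℕ→ℚ k * (τ + τ)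
      scale    : ρ * pow k ≡ τ

    f-B : f B ≤ f X + Λ
    f-B = ≤-trans (f-mono B (⊥ ∪ B) (∪ʳ ⊆-refl))
      (≤-trans (transfer ⊥) (+-monoˡ-≤ Λ (f-mono (⊥ ∪ X) X (∪-elim ⊥⊆ ⊆-refl))))

    -- The 4 in `w` is chosen for this: `4 (ℓ + 1) Λ ≤ 2 k τ ≤ 2 (ℓ + 1) τ`.
    half-loss : 0ℚ ≤ τ → k ℕ.≤ suc ℓ → Λ + Λ ≤ τ
    half-loss 0≤τ k≤ = *-cancelˡ-≤ {S + S} 0<2S (≤-trans (≤-reflexive eq)
      (≤-trans loss (≤-trans (*-monoʳ-≤ (≤-trans 0≤τ (p≤p+q 0≤τ)) (ℕ→ℚ-mono-≤ {k} {suc ℓ} k≤))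
        (≤-reflexive (eq₂ S τ)))))
      where
      S = ℕ→ℚ (suc ℓ)
      0<2S : 0ℚ < S + S
      0<2S = <-≤-trans (ℕ→ℚ-pos ℓ) (p≤p+q (<⇒≤ (ℕ→ℚ-pos ℓ)))
      eq₁ : ∀ s l → (s + s) * (l + l) ≡ ℕ→ℚ 4 * s * l
      eq₁ = solve-∀ ℚ-ring
      eq₂ : ∀ s t → s * (t + t) ≡ (s + s) * t
      eq₂ = solve-∀ ℚ-ring
      eq : (S + S) * (Λ + Λ) ≡ ℕ→ℚ w * Λ
      eq = trans (eq₁ S Λ) (cong (_* Λ) (sym (ℕ→ℚ-* 4 (suc ℓ))))

  -- Rounding down in `width` is made good by the extra bucket, so
  -- `w a x ≤ 2 ^ k * cost c E ≤ 2 ^ k * a`, and `a` cancels.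
  width-suffices : ∀ k {x} → 0ℚ ≤ x → ℕ→ℚ (suc (width q k)) * x ≤ cost c E → ℕ→ℚ w * x ≤ pow k
  width-suffices k {x} 0≤x light = *-cancelˡ-≤ {ℕ→ℚ a} 0<a
    (≤-trans (≤-reflexive (trans (eq₁ (ℕ→ℚ a) (ℕ→ℚ w) x) (cong (_* x) (sym (ℕ→ℚ-* w a)))))
    (≤-trans (*-monoʳ-≤ 0≤x (ℕ→ℚ-mono-≤ {q} {suc (width q k) ℕ.* 2 ℕ.^ k} q≤))
    (≤-trans (≤-reflexive (trans (cong (_* x) (trans (ℕ→ℚ-* (suc (width q k)) (2 ℕ.^ k)) (cong (ℕ→ℚ (suc (width q k)) *_) (sym (pow-def k)))))
                                 (eq₂ (ℕ→ℚ (suc (width q k))) (pow k) x)))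
    (≤-trans (*-monoˡ-≤ (pow-nonNeg k) (≤-trans light (<⇒≤ cost-E)))
    (≤-reflexive (*-comm (pow k) (ℕ→ℚ a)))))))
    where
    instance _ = ℕ.m^n≢0 2 k
    q≤ : q ℕ.≤ suc (width q k) ℕ.* 2 ℕ.^ k
    q≤ = ℕ.≤-trans (ℕ.≤-reflexive (m≡m%n+[m/n]*n q (2 ℕ.^ k)))
      (ℕ.+-monoˡ-≤ (width q k ℕ.* 2 ℕ.^ k) (ℕ.<⇒≤ (m%n<n q (2 ℕ.^ k))))
    eq₁ : ∀ a w x → a * (w * x) ≡ (w * a) * x
    eq₁ = solve-∀ ℚ-ring
    eq₂ : ∀ m p x → m * p * x ≡ p * (m * x)
    eq₂ = solve-∀ ℚ-ring

  Rejects : ℚ → Subset n → Subset n → Set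
  Rejects ρ B U = ∀ {e} → e ∈ U → f (B ∪ ⁅ e ⁆) ≤ f B + ρ * c e

  -- Either a chosen bucket was full, or the discarded part is worth little. Doubling avoids halves:
  -- the bound comes from `f R ≤ s + Λ + τ` with `Λ + Λ ≤ τ`.
  Outcome : ℚ → Subset n → Set
  Outcome τ L = τ ≤ (s + s) ⊎
    (∀ R → R ⊆ L → cost c R ≤ K → f R + f R ≤ (s + s) + (τ + (τ + τ)))

  -- The threshold of the last bucket was `ρ + ρ`, that is `τ` over `pow ℓ`, and `R` costs at most
  -- `K ≤ pow ℓ`; so `R` adds at most `τ` to `B`.
  last-level : ∀ {τ ρ Λ U B X} → 0ℚ ≤ ρ → Chain τ ρ Λ (suc ℓ) B X → Rejects (ρ + ρ) B U → Outcome τ U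
  last-level {τ} {ρ} {Λ} {U} {B} {X} 0≤ρ chain rejects = inj₂ λ R R⊆U R≤K →
    let fR≤ : f R ≤ f B + (ρ + ρ) * pow ℓ
        fR≤ = ≤-trans (f-marginals {B} {R} {B} {R} {ρ + ρ} (rejects ∘ R⊆U) ⊆-refl (∪ʳ ⊆-refl))
                (+-monoʳ-≤ (f B) (*-monoˡ-≤ (≤-trans 0≤ρ (p≤p+q 0≤ρ)) (≤-trans R≤K K≤)))
        fB≤ = ≤-trans f-B (+-monoˡ-≤ Λ (f-survivors survives cost-X))
    in ≤-from-sum (+-mono-≤ (+-mono-≤ fR≤ fR≤) (+-mono-≤ (+-mono-≤ fB≤ fB≤)
         (+-mono-≤ (half-loss 0≤τ ℕ.≤-refl) (+-mono-≤ τ≤ τ≤))))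
       (eq (f R) (f B) ((ρ + ρ) * pow ℓ) s Λ τ)
    where
    open Chain chain
    0≤τ : 0ℚ ≤ τ
    0≤τ = subst (0ℚ ≤_) scale (*-nonNeg 0≤ρ (pow-nonNeg (suc ℓ)))
    eq′ : ∀ r p → (r + r) * p ≡ r * (p + p)
    eq′ = solve-∀ ℚ-ring
    τ≤ : (ρ + ρ) * pow ℓ ≤ τ
    τ≤ = ≤-reflexive (trans (eq′ ρ (pow ℓ)) (trans (cong (ρ *_) (sym (pow-suc ℓ))) scale))
    eq : ∀ r b p s l t →
      r + r + (b + p + (b + p) + ((s + l + (s + l)) + (t + (t + t)))) ≡
      (s + s) + (t + (t + t)) + (r + r + ((b + b) + ((l + l) + (p + p))))
    eq = solve-∀ ℚ-ring

  -- Induction on the `r` levels still to come. The lightest bucket `B′` of level `k` is either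
  -- full, which settles the matter, or rejects all that the level leaves over, which is the
  -- hypothesis for the next level.
  levels-outcome : ∀ r {k τ ρ Λ U B X} → k ℕ.+ r ≡ suc ℓ → 0ℚ ≤ ρ → Chain τ ρ Λ k B X → Rejects (ρ + ρ) B U →
    (∀ {e} → e ∈ U → f ⁅ e ⁆ ≤ τ) → (∀ {e} → e ∈ U → e ∉ levels q r k ρ U → e ∈ T) →
    Outcome τ (levels q r k ρ U)
  levels-outcome zero {k} k≡ 0≤ρ chain rejects f≤τ removed⊆T
    with refl ← trans (sym (ℕ.+-identityʳ k)) k≡ = last-level 0≤ρ chain rejects
  levels-outcome (suc r) {k} {τ} {ρ} {Λ} {U} {B} {X} k≡ 0≤ρ chain rejects f≤τ removed⊆T =
    conclude (pow k ≤? cost c B′)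
    where
    U₁ = peel (bucket (pow k) ρ) (suc (width q k)) U
    found = peel-pigeonhole 0≤c (λ U → proj₁ (proj₁ (bucket-spec ρ (pow-nonNeg k) U))) E (width q k) U
    U′ = proj₁ found
    U′⊆ : U′ ⊆ U
    U′⊆ = proj₁ (proj₂ found)
    B′ = bucket (pow k) ρ U′
    peel⊆ : U₁ ⊆ U′ ∩ ∁ B′
    peel⊆ = proj₁ (proj₂ (proj₂ found))
    light : ℕ→ℚ (suc (width q k)) * cost c (E ∩ B′) ≤ cost c (E ∩ U)
    light = proj₂ (proj₂ (proj₂ found))
    open Chain chain
    σ = pow k
    B′-dense = proj₁ (bucket-spec ρ (pow-nonNeg k) U′)
    X′ = X ∪ (B′ ∩ ∁ E)
    x = cost c (E ∩ B′)
    Λ′ = Λ + (ρ + ρ) * x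

    0≤τ : 0ℚ ≤ τ
    0≤τ = subst (0ℚ ≤_) scale (*-nonNeg 0≤ρ (pow-nonNeg k))

    -- The elements of `B′` were peeled off on this level, so they are absent from the final
    -- remainder.
    B′⊆T : B′ ⊆ T
    B′⊆T e∈B′ = removed⊆T (U′⊆ (proj₁ B′-dense e∈B′))
      λ e∈L → x∈∁p⇒x∉p (∩ʳ {p = U′} (peel⊆ (levels-⊆ q r (suc k) (½ * ρ) U₁ e∈L))) e∈B′

    -- Passing from `B′` to its survivors loses only `E ∩ B′`, which `B` rejected with threshold
    -- `ρ + ρ`. Adding `B` makes that loss payable; `transfer` at `Y ∪ (B′ ∩ ∁ E)` then trades `B`
    -- for `X`.
    transfer′ : ∀ Y → f (Y ∪ B′) ≤ f (Y ∪ X′) + Λ′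
    transfer′ Y = ≤-from-sum
      (+-mono-≤ (f-marginals {B} {E ∩ B′} {(Y ∪ (B′ ∩ ∁ E)) ∪ B} {Y ∪ B′} {ρ + ρ}
          (λ e∈ → rejects (U′⊆ (proj₁ B′-dense (∩ʳ {p = E} e∈)))) (∪ʳ ⊆-refl)
          (∪-elim (∪ˡ (∪ˡ (∪ˡ ⊆-refl)))
            (⊆-trans (split-by E) (∪-elim (∪ʳ (∩-intro ∩ʳ ∩ˡ)) (∪ˡ (∪ˡ (∪ʳ ⊆-refl)))))))
      (+-mono-≤ (transfer (Y ∪ (B′ ∩ ∁ E)))
        (f-mono ((Y ∪ (B′ ∩ ∁ E)) ∪ X) (Y ∪ X′)
          (∪-elim (∪-elim (∪ˡ ⊆-refl) (∪ʳ (∪ʳ ⊆-refl))) (∪ʳ (∪ˡ ⊆-refl))))))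
      (eq (f (Y ∪ B′)) (f ((Y ∪ (B′ ∩ ∁ E)) ∪ B)) ((ρ + ρ) * x) (f ((Y ∪ (B′ ∩ ∁ E)) ∪ X)) Λ (f (Y ∪ X′)))
      where
      eq : ∀ y b t d l z → y + (b + t + (d + l + z)) ≡ (z + (l + t)) + (y + (b + d))
      eq = solve-∀ ℚ-ring

    loss′ : ℕ→ℚ w * Λ′ ≤ ℕ→ℚ (suc k) * (τ + τ)
    loss′ = ≤-trans (≤-reflexive (eq₁ (ℕ→ℚ w) Λ ρ x)) (≤-trans
      (+-mono-≤ loss (*-monoˡ-≤ (≤-trans 0≤ρ (p≤p+q 0≤ρ)) (width-suffices k (0≤cost (E ∩ B′))
        (≤-trans light (cost-mono 0≤c ∩ˡ)))))
      (≤-reflexive (trans (cong (λ t → ℕ→ℚ k * (τ + τ) + t) (trans (*-distribʳ-+ σ ρ ρ) (cong₂ _+_ scale scale)))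
        (trans (eq₂ (ℕ→ℚ k) (τ + τ)) (cong (_* (τ + τ)) (sym (ℕ→ℚ-suc k)))))))
      where
      eq₁ : ∀ w l r x → w * (l + (r + r) * x) ≡ w * l + (r + r) * (w * x)
      eq₁ = solve-∀ ℚ-ring
      eq₂ : ∀ k t → k * t + t ≡ (1ℚ + k) * t
      eq₂ = solve-∀ ℚ-ring

    chain′ : Chain τ (½ * ρ) Λ′ (suc k) B′ X′
    chain′ = record
      { transfer = transfer′
      ; survives = ∪-elim survives (∩-intro (⊆-trans ∩ˡ B′⊆T) ∩ʳ)
      ; cost-X   = ≤-trans (cost-∪ 0≤c X (B′ ∩ ∁ E)) (≤-trans
          (+-mono-≤ cost-X (≤-trans (cost-mono 0≤c ∩ˡ) (proj₁ (proj₂ B′-dense))))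
          (≤-reflexive (trans (cong (pow (suc k) +_) (sym (pow-suc k))) (sym (pow-suc (suc k))))))
      ; loss     = loss′
      ; scale    = trans (cong (½ * ρ *_) (pow-suc k)) (trans (eq ρ σ) scale)
      }
      where
      eq : ∀ r s → ½ * r * (s + s) ≡ r * s
      eq = solve-∀ ℚ-ring

    conclude : Dec (σ ≤ cost c B′) → Outcome τ (levels q (suc r) k ρ U)
    -- A full bucket is worth at least `ρ * σ = τ`, so `τ ≤ s + Λ′`; twice this and `Λ′ + Λ′ ≤ τ`
    -- give `τ ≤ s + s`.
    conclude (yes full) = inj₁ (≤-from-sum
      (+-mono-≤ τ≤ (+-mono-≤ τ≤ (Chain.half-loss chain′ 0≤τ k<)))
      (eq τ Λ′ s))
      where
      k< : suc k ℕ.≤ suc ℓ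
      k< = ℕ.≤-trans (ℕ.m≤m+n (suc k) r) (ℕ.≤-reflexive (trans (sym (ℕ.+-suc k r)) k≡))
      τ≤ : τ ≤ s + Λ′
      τ≤ = ≤-trans (≤-reflexive (sym scale)) (≤-trans (*-monoˡ-≤ 0≤ρ full)
        (≤-trans (proj₂ (proj₂ B′-dense)) (≤-trans (Chain.f-B chain′)
        (+-monoˡ-≤ Λ′ (f-survivors (Chain.survives chain′) (≤-trans (Chain.cost-X chain′) (pow-mono (ℕ.s≤s k<))))))))
      eq : ∀ t l s → t + (s + l + (s + l + t)) ≡ (s + s) + (t + (t + (l + l)))
      eq = solve-∀ ℚ-ring
    conclude (no unfull) = levels-outcome r (trans (sym (ℕ.+-suc k r)) k≡)
      (*-nonNeg (<⇒≤ (positive⁻¹ ½)) 0≤ρ) chain′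
      (λ {e} e∈ → ≤-trans
        (bucket-maximal (pow-nonNeg k) 0≤ρ (≰⇒> unfull) (∩ˡ (peel⊆ e∈))
          (≤-trans (f≤τ (peel-⊆ (suc (width q k)) U e∈)) (≤-reflexive (sym scale))))
        (+-monoʳ-≤ (f B′) (≤-reflexive (eq ρ (c e)))))
      (f≤τ ∘ peel-⊆ (suc (width q k)) U)
      (removed⊆T ∘ peel-⊆ (suc (width q k)) U)
      where
      eq : ∀ r x → r * x ≡ (½ * r + ½ * r) * x
      eq = solve-∀ ℚ-ring

  -- The invariant is `τ ≤ 4 s`. A scale with `τ ≤ 2 s` may be doubled; the other outcome gives
  -- `2 f R ≤ 2 s + 3 τ ≤ 14 s`, hence the bound `7 s`.
  scales-outcome : ∀ r {τ U} → 0ℚ ≤ τ → τ ≤ (s + s + (s + s)) → (∀ {e} → e ∈ U → f ⁅ e ⁆ ≤ τ) →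
    (∀ {e} → e ∈ U → e ∉ scales q ℓ r τ U → e ∈ T) →
    pow r * τ ≤ (s + s + (s + s)) ⊎
    (∀ R → R ⊆ scales q ℓ r τ U → cost c R ≤ K → f R ≤ s + s + (s + s) + (s + s + s))
  scales-outcome zero {τ} 0≤τ τ≤ f≤τ removed⊆T = inj₁ (≤-trans (≤-reflexive (trans (cong (_* τ) (pow-def 0)) (*-identityˡ τ))) τ≤)
  scales-outcome (suc r) {τ} {U} 0≤τ τ≤ f≤τ removed⊆T
    with levels-outcome (suc ℓ) refl 0≤τ start
           -- The chain starts from the empty bucket, which rejects everything because `f ⁅ e ⁆ ≤ τ`
           -- and costs are at least 1.
           (λ {e} e∈U → ≤-trans (f-subadditive ⊆-refl) (+-monoʳ-≤ (f ⊥)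
             (≤-trans (f≤τ e∈U) (≤-trans (≤-reflexive (sym (*-identityʳ τ))) (*-mono (1≤c e))))))
           f≤τ (λ e∈U e∉ → removed⊆T e∈U (e∉ ∘ scales-⊆ q ℓ r (τ + τ) _))
    where
    *-mono : ∀ {y} → 1ℚ ≤ y → τ * 1ℚ ≤ (τ + τ) * y
    *-mono 1≤y = ≤-trans (*-monoˡ-≤ 0≤τ 1≤y) (*-monoʳ-≤ (≤-trans (<⇒≤ 0<1) 1≤y) (p≤p+q {τ} 0≤τ))
    start : Chain τ τ 0ℚ 0 ⊥ ⊥
    start = record
      { transfer = λ Y → p≤p+q ≤-refl
      ; survives = ⊥⊆
      ; cost-X   = cost-⊥≤ (pow-nonNeg 1)
      ; loss     = ≤-reflexive (trans (*-zeroʳ (ℕ→ℚ w)) (sym (*-zeroˡ (τ + τ))))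
      ; scale    = trans (cong (τ *_) (pow-def 0)) (*-identityʳ τ)
      }
  ... | inj₂ small = inj₂ λ R R⊆ R≤K → *-cancelˡ-≤ {1ℚ + 1ℚ} (positive⁻¹ (1ℚ + 1ℚ)) (≤-from-sum
          (+-mono-≤ (small R (scales-⊆ q ℓ r (τ + τ) _ ∘ R⊆) R≤K) (+-mono-≤ τ≤ (+-mono-≤ τ≤ τ≤)))
          (eq (f R) s τ))
    where
    eq : ∀ r s t → (1ℚ + 1ℚ) * r + (s + s + (t + (t + t)) + (s + s + (s + s) + (s + s + (s + s) + (s + s + (s + s)))))
       ≡ (1ℚ + 1ℚ) * (s + s + (s + s) + (s + s + s)) + (r + r + (t + (t + t)))
    eq = solve-∀ ℚ-ring
  ... | inj₁ τ≤2s with scales-outcome r {τ + τ} (≤-trans 0≤τ (p≤p+q 0≤τ))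
          (+-mono-≤ τ≤2s τ≤2s)
          (λ e∈ → ≤-trans (f≤τ (levels-⊆ q (suc ℓ) 0 τ U e∈)) (p≤p+q 0≤τ))
          (λ e∈ → removed⊆T (levels-⊆ q (suc ℓ) 0 τ U e∈))
  ...   | inj₂ small = inj₂ small
  ...   | inj₁ big = inj₁ (≤-trans (≤-reflexive (trans (cong (_* τ) (pow-suc r)) (eq′ (pow r) τ))) big)
    where
    eq′ : ∀ p t → (p + p) * t ≡ p * (t + t)
    eq′ = solve-∀ ℚ-ring

-- Approximation by the stored set, and its size.

module Guarantee {n} {f : Subset n → ℚ} {c : Fin n → ℚ} {K : ℚ}
  (f-nonNeg : NonNeg f) (f-mono : Monotone f) (f-sub : Submodular f)
  (1≤c : CostsAtLeastOne c) (0≤K : 0ℚ ≤ K)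
  (a′ ℓ : ℕ) (K≤ : K ≤ pow ℓ) (≤2K : pow ℓ ≤ K + K) where

  open Algorithm f c K
  open Analysis f-nonNeg f-mono f-sub 1≤c 0≤K

  a q : ℕ
  a = suc a′
  q = 4 ℕ.* suc ℓ ℕ.* a

  U₀ T : Subset n
  U₀ = afterTop a
  T = stored a ℓ

  Δ : ℚ
  Δ = f (top U₀)

  -- `S ∩ T` is affordable and survives, so it is worth at most `v`; the elements of `S` outside `T`
  -- are cheap, hence in `leftover`, where `scales-outcome` bounds them by `7 s`.
  stored-approximates : ∀ {E v} → cost c E < ℕ→ℚ a →
    (∀ Z → FeasibleIn (T ∩ ∁ E) Z → f Z ≤ v) →
    ∀ {s} → ℕ→ℚ 17 * v ≤ s →
    ∀ S → S ⊆ ∁ E → cost c S ≤ K → f S ≤ v + (s + s + (s + s) + (s + s + s))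
  stored-approximates {E} {v} cost-E bound {s} 17v≤s S S⊆ S≤K =
    ≤-trans (f-subadditive (split-by T))
      (+-mono-≤ (bound (S ∩ T) (∩-intro ∩ʳ (S⊆ ∘ ∩ˡ) , ≤-trans (cost-mono 0≤c ∩ˡ) S≤K)) fR≤)
    where
    open Recovery {f = f} f-nonNeg f-mono f-sub 1≤c 0≤K a ℓ K≤ ≤2K {E} {T} {v} cost-E ∩ˡ bound 17v≤s
      using (scales-outcome)

    found = peel-pigeonhole 0≤c (λ U → proj₁ (proj₁ (proj₁ (top-spec U)))) E a′ cheap
    U′ = proj₁ found
    B = top U′
    U₀⊆ : U₀ ⊆ U′ ∩ ∁ B
    U₀⊆ = proj₁ (proj₂ (proj₂ found))
    light : ℕ→ℚ a * cost c (E ∩ B) ≤ cost c E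
    light = ≤-trans (proj₂ (proj₂ (proj₂ found))) (cost-mono 0≤c ∩ˡ)

    -- The lightest of `a` buckets loses cost at most `cost c E / a < 1`, and every element costs at
    -- least 1, so it loses nothing.
    E∩B-empty : ∀ {e} → e ∉ E ∩ B
    E∩B-empty = cost<1⇒∉ (≰⇒> λ 1≤x → <-irrefl refl (≤-<-trans
      (≤-trans (≤-reflexive (sym (*-identityʳ (ℕ→ℚ a))))
        (≤-trans (*-monoˡ-≤ (ℕ→ℚ-nonNeg a) 1≤x) light)) cost-E))

    B-feasible : FeasibleIn (T ∩ ∁ E) B
    B-feasible = ∩-intro
        (∩-intro (proj₁ (proj₂ found) ∘ B⊆U′)
          λ e∈B → x∉p⇒x∈∁p λ e∈L → x∈∁p⇒x∉p (∩ʳ {p = U′} (U₀⊆ (scales-⊆ q ℓ ℓ Δ U₀ e∈L))) e∈B)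
        (λ e∈B → x∉p⇒x∈∁p λ e∈E → E∩B-empty (x∈p∩q⁺ (e∈E , e∈B)))
      , proj₂ (proj₁ (proj₁ (top-spec U′)))
      where
      B⊆U′ : B ⊆ U′
      B⊆U′ = proj₁ (proj₁ (proj₁ (top-spec U′)))

    Δ≤v : Δ ≤ v
    Δ≤v with (top⊆ , top≤K) , card≤1 ← proj₁ (top-spec U₀) =
      ≤-trans (proj₂ (top-spec U′) (top U₀) ((∩ˡ ∘ U₀⊆ ∘ top⊆ , top≤K) , card≤1)) (bound B B-feasible)

    0≤Δ : 0ℚ ≤ Δ
    0≤Δ = f-nonNeg (top U₀)

    v≤s : v ≤ s
    v≤s = ≤-trans (≤-trans (≤-reflexive (sym (*-identityˡ v)))
      (*-monoʳ-≤ {v} {1ℚ} {ℕ→ℚ 17} (≤-trans 0≤Δ Δ≤v) (ℕ→ℚ-mono-≤ {1} {17} (ℕ.s≤s ℕ.z≤n)))) 17v≤s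

    0≤s : 0ℚ ≤ s
    0≤s = ≤-trans 0≤Δ (≤-trans Δ≤v v≤s)

    0≤2s : 0ℚ ≤ s + s
    0≤2s = ≤-trans 0≤s (p≤p+q 0≤s)

    f≤Δ : ∀ {e} → e ∈ U₀ → f ⁅ e ⁆ ≤ Δ
    f≤Δ {e} e∈ = proj₂ (top-spec U₀) ⁅ e ⁆
      ((⁅⁆⊆ e∈ , ≤-trans (≤-reflexive (cost-⁅⁆ c e)) (cheap⇒≤K (peel-⊆ {b = top} a cheap e∈)))
      , ℕ.≤-reflexive (∣⁅x⁆∣≡1 e))

    R = S ∩ ∁ T

    R⊆leftover : R ⊆ leftover a ℓ
    R⊆leftover {e} e∈R with e ∈? leftover a ℓ
    ... | yes e∈L = e∈L
    ... | no e∉L = contradiction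
      (x∈p∩q⁺ (≤K⇒cheap (≤-trans (c≤cost (∩ˡ {p = S} e∈R)) S≤K) , x∉p⇒x∈∁p e∉L))
      (x∈∁p⇒x∉p (∩ʳ {p = S} e∈R))

    R≤K : cost c R ≤ K
    R≤K = ≤-trans (cost-mono 0≤c ∩ˡ) S≤K

    fR≤ : f R ≤ s + s + (s + s) + (s + s + s)
    fR≤ = [ fromΔ , (λ small → small R R⊆leftover R≤K) ]′
      (scales-outcome ℓ 0≤Δ
        (≤-trans (≤-trans Δ≤v v≤s) (≤-trans (p≤p+q 0≤s) (p≤p+q 0≤2s)))
        f≤Δ (λ e∈ e∉ → x∈p∩q⁺ (peel-⊆ {b = top} a cheap e∈ , x∉p⇒x∈∁p e∉)))
      where
      eq : ∀ s → s + (s + s + (s + s)) + (s + s) ≡ s + s + (s + s) + (s + s + s) + 0ℚ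
      eq = solve-∀ ℚ-ring
      -- All scales passed: each discarded element has density at most `Δ` and `R` costs at most
      -- `pow ℓ`, so `f R ≤ s + 4 s`, padded to `7 s`.
      fromΔ : pow ℓ * Δ ≤ s + s + (s + s) → f R ≤ s + s + (s + s) + (s + s + s)
      fromΔ big = ≤-trans
          (f-marginals {⊥} {R} {⊥} {R} {Δ}
            (λ {e} e∈R → ≤-trans (f-subadditive ⊆-refl) (+-monoʳ-≤ (f ⊥)
              (≤-trans (f≤Δ (scales-⊆ q ℓ ℓ Δ U₀ (R⊆leftover e∈R)))
                (≤-trans (≤-reflexive (sym (*-identityʳ Δ))) (*-monoˡ-≤ 0≤Δ (1≤c e))))))
            ⊆-refl (∪ʳ ⊆-refl))
          (≤-trans (+-mono-≤ (≤-trans (bound ⊥ (⊥⊆ , cost-⊥≤ 0≤K)) v≤s)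
            (≤-trans (*-monoˡ-≤ 0≤Δ (≤-trans R≤K K≤)) (≤-trans (≤-reflexive (*-comm Δ (pow ℓ))) big)))
          (≤-from-sum 0≤2s (eq s)))

  bucket-size : ∀ k ρ U → ∣ bucket (pow k) ρ U ∣ ℕ.≤ 2 ℕ.^ k ℕ.+ 2 ℕ.^ k
  bucket-size k ρ U = ℕ→ℚ-cancel-≤ {∣ bucket (pow k) ρ U ∣} {2 ℕ.^ k ℕ.+ 2 ℕ.^ k}
    (≤-trans (∣p∣≤cost 1≤c (bucket (pow k) ρ U))
    (≤-trans (proj₁ (proj₂ (proj₁ (bucket-spec ρ (pow-nonNeg k) U))))
    (≤-reflexive (trans (cong (λ p → p + p) (pow-def k)) (sym (ℕ→ℚ-+ (2 ℕ.^ k) (2 ℕ.^ k)))))))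

  -- A bound independent of the level: `q / 2 ^ k + 1` buckets with at most `2 * 2 ^ k` elements
  -- each, and `k ≤ ℓ`.
  levelSize : ℕ
  levelSize = (q ℕ.+ 2 ℕ.^ ℓ) ℕ.+ (q ℕ.+ 2 ℕ.^ ℓ)

  level-size : ∀ {k} → k ℕ.≤ ℓ → suc (width q k) ℕ.* (2 ℕ.^ k ℕ.+ 2 ℕ.^ k) ℕ.≤ levelSize
  level-size {k} k≤ℓ = ℕ.≤-trans (ℕ.≤-reflexive (ℕ.*-distribˡ-+ (suc (width q k)) (2 ℕ.^ k) (2 ℕ.^ k)))
    (ℕ.+-mono-≤ half half)
    where
    half : suc (width q k) ℕ.* 2 ℕ.^ k ℕ.≤ q ℕ.+ 2 ℕ.^ ℓ
    half = ℕ.≤-trans (ℕ.+-mono-≤ (ℕ.^-monoʳ-≤ 2 k≤ℓ) (m/n*n≤m q (2 ℕ.^ k) {{ℕ.m^n≢0 2 k}}))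
      (ℕ.≤-reflexive (ℕ.+-comm (2 ℕ.^ ℓ) q))

  levels-size : ∀ r k ρ U → k ℕ.+ r ≡ suc ℓ → ∣ U ∣ ℕ.≤ ∣ levels q r k ρ U ∣ ℕ.+ r ℕ.* levelSize
  levels-size zero k ρ U _ = ℕ.m≤m+n ∣ U ∣ 0
  levels-size (suc r) k ρ U k+r≡ = begin
    ∣ U ∣                                                       ≤⟨ peel-size (bucket-size k ρ) (suc (width q k)) U ⟩
    ∣ U₁ ∣ ℕ.+ suc (width q k) ℕ.* (2 ℕ.^ k ℕ.+ 2 ℕ.^ k)       ≤⟨ ℕ.+-mono-≤ (levels-size r (suc k) (½ * ρ) U₁ k+r≡′) (level-size k≤ℓ) ⟩
    L ℕ.+ r ℕ.* levelSize ℕ.+ levelSize                         ≡⟨ ℕ.+-assoc L (r ℕ.* levelSize) levelSize ⟩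
    L ℕ.+ (r ℕ.* levelSize ℕ.+ levelSize)                       ≡⟨ cong (L ℕ.+_) (ℕ.+-comm (r ℕ.* levelSize) levelSize) ⟩
    L ℕ.+ suc r ℕ.* levelSize                                   ∎
    where
    open ℕ.≤-Reasoning
    U₁ = peel (bucket (pow k) ρ) (suc (width q k)) U
    L = ∣ levels q r (suc k) (½ * ρ) U₁ ∣
    k+r≡′ : suc k ℕ.+ r ≡ suc ℓ
    k+r≡′ = trans (sym (ℕ.+-suc k r)) k+r≡
    k≤ℓ : k ℕ.≤ ℓ
    k≤ℓ = ℕ.≤-trans (ℕ.m≤m+n k r) (ℕ.≤-reflexive (ℕ.suc-injective k+r≡′))

  scales-size : ∀ r τ U → ∣ U ∣ ℕ.≤ ∣ scales q ℓ r τ U ∣ ℕ.+ r ℕ.* (suc ℓ ℕ.* levelSize)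
  scales-size zero τ U = ℕ.m≤m+n ∣ U ∣ 0
  scales-size (suc r) τ U = begin
    ∣ U ∣                       ≤⟨ levels-size (suc ℓ) 0 τ U refl ⟩
    ∣ U₁ ∣ ℕ.+ x                ≤⟨ ℕ.+-monoˡ-≤ x (scales-size r (τ + τ) U₁) ⟩
    L ℕ.+ r ℕ.* x ℕ.+ x         ≡⟨ ℕ.+-assoc L (r ℕ.* x) x ⟩
    L ℕ.+ (r ℕ.* x ℕ.+ x)       ≡⟨ cong (L ℕ.+_) (ℕ.+-comm (r ℕ.* x) x) ⟩
    L ℕ.+ suc r ℕ.* x           ∎
    where
    open ℕ.≤-Reasoning
    x = suc ℓ ℕ.* levelSize
    U₁ = levels q (suc ℓ) 0 τ U
    L = ∣ scales q ℓ r (τ + τ) U₁ ∣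

  stored-size : ∣ T ∣ ℕ.≤ ℓ ℕ.* (suc ℓ ℕ.* levelSize) ℕ.+ a
  stored-size = ℕ.+-cancelʳ-≤ L ∣ T ∣ (x ℕ.+ a) (begin
    ∣ T ∣ ℕ.+ L            ≤⟨ ∣p∩∁q∣+∣q∣≤∣p∣ cheap (leftover a ℓ) leftover⊆ ⟩
    ∣ cheap ∣              ≤⟨ peel-size (λ U → proj₂ (proj₁ (top-spec U))) a cheap ⟩
    ∣ U₀ ∣ ℕ.+ a ℕ.* 1     ≤⟨ ℕ.+-mono-≤ (scales-size ℓ Δ U₀) (ℕ.≤-reflexive (ℕ.*-identityʳ a)) ⟩
    L ℕ.+ x ℕ.+ a          ≡⟨ ℕ.+-assoc L x a ⟩
    L ℕ.+ (x ℕ.+ a)        ≡⟨ ℕ.+-comm L (x ℕ.+ a) ⟩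
    x ℕ.+ a ℕ.+ L          ∎)
    where
    open ℕ.≤-Reasoning
    L = ∣ leftover a ℓ ∣
    x = ℓ ℕ.* (suc ℓ ℕ.* levelSize)
    leftover⊆ : leftover a ℓ ⊆ cheap
    leftover⊆ = ⊆-trans (scales-⊆ q ℓ ℓ Δ U₀) (peel-⊆ {b = top} a cheap)

  -- With `ℓ + 1 ≤ 2 P` the levels contribute `P * 2P * 2 (8 P a + 2 ^ ℓ P)`, that is 32 and 4; the
  -- `a` top elements raise 32 to 33.
  stored-size-polylog : ∀ {P} → ℓ ℕ.≤ P → 1 ℕ.≤ P →
    ∣ T ∣ ℕ.≤ (33 ℕ.* a ℕ.+ 4 ℕ.* 2 ℕ.^ ℓ) ℕ.* (P ℕ.* (P ℕ.* P))
  stored-size-polylog {P} ℓ≤P 1≤P = begin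
    ∣ T ∣                                                  ≤⟨ stored-size ⟩
    ℓ ℕ.* (suc ℓ ℕ.* levelSize) ℕ.+ a                      ≤⟨ ℕ.+-mono-≤ (ℕ.*-mono-≤ ℓ≤P (ℕ.*-mono-≤ sucℓ≤ (ℕ.+-mono-≤ half≤ half≤))) a≤ ⟩
    P ℕ.* ((P ℕ.+ P) ℕ.* (h ℕ.+ h)) ℕ.+ a ℕ.* (P ℕ.* (P ℕ.* P)) ≡⟨ eq P a X ⟩
    (33 ℕ.* a ℕ.+ 4 ℕ.* X) ℕ.* (P ℕ.* (P ℕ.* P))            ∎
    where
    open ℕ.≤-Reasoning
    X = 2 ℕ.^ ℓ
    h = 4 ℕ.* (P ℕ.+ P) ℕ.* a ℕ.+ X ℕ.* P
    sucℓ≤ : suc ℓ ℕ.≤ P ℕ.+ P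
    sucℓ≤ = ℕ.+-mono-≤ 1≤P ℓ≤P
    half≤ : q ℕ.+ X ℕ.≤ h
    half≤ = ℕ.+-mono-≤ (ℕ.*-monoˡ-≤ a (ℕ.*-monoʳ-≤ 4 sucℓ≤))
      (ℕ.≤-trans (ℕ.≤-reflexive (sym (ℕ.*-identityʳ X))) (ℕ.*-monoʳ-≤ X 1≤P))
    a≤ : a ℕ.≤ a ℕ.* (P ℕ.* (P ℕ.* P))
    a≤ = ℕ.≤-trans (ℕ.≤-reflexive (sym (ℕ.*-identityʳ a)))
      (ℕ.*-monoʳ-≤ a (ℕ.*-mono-≤ 1≤P (ℕ.*-mono-≤ 1≤P 1≤P)))
    eq : ∀ P a X → P ℕ.* ((P ℕ.+ P) ℕ.* ((4 ℕ.* (P ℕ.+ P) ℕ.* a ℕ.+ X ℕ.* P) ℕ.+ (4 ℕ.* (P ℕ.+ P) ℕ.* a ℕ.+ X ℕ.* P))) ℕ.+ a ℕ.* (P ℕ.* (P ℕ.* P))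
       ≡ (33 ℕ.* a ℕ.+ 4 ℕ.* X) ℕ.* (P ℕ.* (P ℕ.* P))
    eq = ℕ-Solver.solve-∀

-- The approximation factor, integer parts and logarithms.

constants : ∀ v → let s = ℕ→ℚ 17 * v in v + (s + s + (s + s) + (s + s + s)) ≡ ℕ→ℚ 120 * v
-- The factor is `1 + 7 * 17 = 120`.
constants v = trans (cong (_+_ v) (trans (eq (ℕ→ℚ 17 * v)) (trans (sym (*-assoc (ℕ→ℚ 7) (ℕ→ℚ 17) v))
    (cong (_* v) (sym (ℕ→ℚ-* 7 17))))))
  (trans (eq′ v (ℕ→ℚ 119)) (cong (_* v) (sym (ℕ→ℚ-suc 119))))
  where
  eq : ∀ s → s + s + (s + s) + (s + s + s) ≡ ℕ→ℚ 7 * s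
  eq = solve-∀ ℚ-ring
  eq′ : ∀ v t → v + t * v ≡ (1ℚ + t) * v
  eq′ = solve-∀ ℚ-ring

-- The search is bounded by the first argument, which has to be at least ⌊q⌋; likewise for log↑.
floor : ℕ → ℚ → ℕ
floor zero q = 0
floor (suc n) q = if does (ℕ→ℚ (suc n) ≤? q) then suc n else floor n q

floor-spec : ∀ n {q} → 0ℚ ≤ q → q < ℕ→ℚ (suc n) → ℕ→ℚ (floor n q) ≤ q × q < ℕ→ℚ (suc (floor n q))
floor-spec zero 0≤q q< = 0≤q , q<
floor-spec (suc n) {q} 0≤q q< = step (ℕ→ℚ (suc n) ≤? q)
  where
  step : (d : Dec (ℕ→ℚ (suc n) ≤ q)) → let m = if does d then suc n else floor n q in
         ℕ→ℚ m ≤ q × q < ℕ→ℚ (suc m)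
  step (yes n≤q) = n≤q , q<
  step (no n≰q) = floor-spec n 0≤q (≰⇒> n≰q)

log↑ : ℕ → ℚ → ℕ
log↑ zero q = 0
log↑ (suc p) q with q ≤? pow p
... | yes _ = log↑ p q
... | no _ = suc p

-- The search descends while `q` still fits, so the power below the result is less than `q`, whence
-- the factor 2; at exponent 0 the hypothesis `1ℚ ≤ q` takes its place.
log↑-spec : ∀ p {q} → 1ℚ ≤ q → q ≤ pow p →
  q ≤ pow (log↑ p q) × pow (log↑ p q) ≤ q + q × log↑ p q ℕ.≤ p
log↑-spec zero 1≤q q≤ = q≤ ,
  ≤-trans (≤-reflexive (pow-def 0)) (≤-trans 1≤q (p≤p+q (≤-trans (<⇒≤ 0<1) 1≤q))) , ℕ.z≤n
log↑-spec (suc p) {q} 1≤q q≤ with q ≤? pow p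
... | yes q≤p = let (lo , hi , le) = log↑-spec p 1≤q q≤p in lo , hi , ℕ.m≤n⇒m≤1+n le
... | no q≰p = q≤ , ≤-trans (≤-reflexive (pow-suc p)) (+-mono-≤ (<⇒≤ (≰⇒> q≰p)) (<⇒≤ (≰⇒> q≰p))) , ℕ.≤-refl

n<2^[1+⌊log₂n⌋] : ∀ n → n ℕ.< 2 ℕ.^ suc ⌊log₂ n ⌋
n<2^[1+⌊log₂n⌋] n = ℕ.≰⇒> λ 2^≤n → ℕ.<-irrefl refl
  (ℕ.≤-trans (ℕ.≤-reflexive (sym (⌊log₂[2^n]⌋≡n (suc ⌊log₂ n ⌋)))) (⌊log₂⌋-mono-≤ 2^≤n))

-- The summary, its degenerate cases and the theorem.

module Summary {n} (f : Subset n → ℚ) (c : Fin n → ℚ) (K M : ℚ) where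

  open Algorithm f c K

  P : ℕ
  P = suc ⌊log₂ n ⌋

  -- If `n ≤ K + M` everything may be kept, and if `K < 1` only the empty set is affordable.
  -- Otherwise `K + M < n` bounds both searches and makes `ℓ` logarithmic in `n`.
  choose : Dec (ℕ→ℚ n ≤ K + M) → Dec (1ℚ ≤ K) → Subset n
  choose (yes _) _ = ⊤
  choose (no _) (no _) = ⊥
  choose (no _) (yes _) = stored (suc (floor n M)) (log↑ P K)

  summary : Subset n
  summary = choose (ℕ→ℚ n ≤? K + M) (1ℚ ≤? K)

  output : Subset n → Subset n
  output E = argMax f (feasibleIn? (summary ∩ ∁ E))

  -- The retrieved set enters only through a bound `v` on all affordable survivors; `output` attains
  -- it.
  Succeeds : Subset n → Set
  Succeeds T =
    (ℕ→ℚ ∣ T ∣ ≤ ℕ→ℚ 41 * (K + M) * polylog n 3) ×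
    (∀ {E v} → cost c E ≤ M → (∀ Z → FeasibleIn (T ∩ ∁ E) Z → f Z ≤ v) →
      ∀ S → S ⊆ ∁ E → cost c S ≤ K → f S ≤ ℕ→ℚ 120 * v)

  module _ (f-nonNeg : NonNeg f) (f-mono : Monotone f) (f-sub : Submodular f)
    (1≤c : CostsAtLeastOne c) (0≤K : 0ℚ ≤ K) (0≤M : 0ℚ ≤ M) where

    open Analysis f-nonNeg f-mono f-sub 1≤c 0≤K

    0≤K+M : 0ℚ ≤ K + M
    0≤K+M = ≤-trans 0≤K (p≤p+q 0≤M)

    P³≡polylog : ℕ→ℚ (P ℕ.* (P ℕ.* P)) ≡ polylog n 3
    P³≡polylog = trans (ℕ→ℚ-* P (P ℕ.* P)) (cong (ℕ→ℚ P *_)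
      (trans (ℕ→ℚ-* P P) (cong (ℕ→ℚ P *_) (sym (*-identityʳ (ℕ→ℚ P))))))

    1≤polylog : 1ℚ ≤ polylog n 3
    1≤polylog = subst (1ℚ ≤_) P³≡polylog (ℕ→ℚ-mono-≤ {1} {P ℕ.* (P ℕ.* P)} (ℕ.s≤s ℕ.z≤n))

    small-size : ∀ {x} → x ≤ K + M → x ≤ ℕ→ℚ 41 * (K + M) * polylog n 3
    small-size {x} x≤ = ≤-trans x≤ (≤-trans (≤-reflexive (eq (K + M)))
      (≤-trans (*-monoʳ-≤ 0≤1 (*-monoʳ-≤ 0≤K+M (ℕ→ℚ-mono-≤ {1} {41} (ℕ.s≤s ℕ.z≤n))))
        (*-monoˡ-≤ (*-nonNeg (ℕ→ℚ-nonNeg 41) 0≤K+M) 1≤polylog)))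
      where
      0≤1 = <⇒≤ 0<1
      eq : ∀ q → q ≡ 1ℚ * q * 1ℚ
      eq = solve-∀ ℚ-ring

    contains-S : ∀ {T E v S} → (∀ Z → FeasibleIn (T ∩ ∁ E) Z → f Z ≤ v) →
      S ⊆ T → S ⊆ ∁ E → cost c S ≤ K → f S ≤ ℕ→ℚ 120 * v
    contains-S {v = v} {S} bound S⊆T S⊆ S≤K = ≤-trans (≤-trans fS≤v (≤-reflexive (sym (*-identityˡ v))))
      (*-monoʳ-≤ (≤-trans (f-nonNeg S) fS≤v) (ℕ→ℚ-mono-≤ {1} {120} (ℕ.s≤s ℕ.z≤n)))
      where fS≤v = bound S (∩-intro S⊆T S⊆ , S≤K)

    choose-succeeds : ∀ d₁ d₂ → Succeeds (choose d₁ d₂)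
    choose-succeeds (yes n≤) _ =
      small-size (≤-trans (≤-reflexive (cong ℕ→ℚ (∣⊤∣≡n n))) n≤) ,
      λ _ bound S → contains-S bound ⊆⊤
    choose-succeeds (no _) (no 1≰K) =
      small-size (≤-trans (≤-reflexive (cong ℕ→ℚ (∣⊥∣≡0 n))) 0≤K+M) ,
      λ _ bound S S⊆ S≤K → contains-S bound
        (λ e∈S → contradiction e∈S (cost<1⇒∉ (≤-<-trans S≤K (≰⇒> 1≰K)))) S⊆ S≤K
    choose-succeeds (no n≰) (yes 1≤K) = size ,
      λ {_} {v} E≤M bound S S⊆ S≤K → ≤-trans
        (stored-approximates (≤-<-trans E≤M (proj₂ a-spec)) bound ≤-refl S S⊆ S≤K)
        (≤-reflexive (constants v))
      where
      K+M<n : K + M < ℕ→ℚ n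
      K+M<n = ≰⇒> n≰
      a′ = floor n M
      a-spec : ℕ→ℚ a′ ≤ M × M < ℕ→ℚ (suc a′)
      a-spec = floor-spec n 0≤M (≤-<-trans (≤-trans (p≤p+q 0≤K) (≤-reflexive (+-comm M K)))
        (<-trans K+M<n (ℕ→ℚ-mono-< {n} {suc n} ℕ.≤-refl)))
      ℓ = log↑ P K
      ℓ-spec : K ≤ pow ℓ × pow ℓ ≤ K + K × ℓ ℕ.≤ P
      ℓ-spec = log↑-spec P 1≤K (≤-trans (p≤p+q 0≤M) (≤-trans (<⇒≤ K+M<n)
        (≤-trans (ℕ→ℚ-mono-≤ {n} {2 ℕ.^ P} (ℕ.<⇒≤ (n<2^[1+⌊log₂n⌋] n))) (≤-reflexive (sym (pow-def P))))))
      open Guarantee {f = f} f-nonNeg f-mono f-sub 1≤c 0≤K a′ ℓ (proj₁ ℓ-spec) (proj₁ (proj₂ ℓ-spec))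

      -- The 1 that makes `a` strictly exceed `M` is absorbed by `1 ≤ K`.
      a≤ : ℕ→ℚ a ≤ K + M
      a≤ = ≤-trans (≤-reflexive (ℕ→ℚ-suc a′)) (+-mono-≤ 1≤K (proj₁ a-spec))
      X≤ : pow ℓ ≤ (K + M) + (K + M)
      X≤ = ≤-trans (proj₁ (proj₂ ℓ-spec)) (+-mono-≤ (p≤p+q {K} 0≤M) (p≤p+q {K} 0≤M))
      -- Since `pow ℓ ≤ 2 (K + M)`, the constant is `33 + 4 * 2 = 41`.
      linear : ℕ→ℚ (33 ℕ.* a ℕ.+ 4 ℕ.* 2 ℕ.^ ℓ) ≤ ℕ→ℚ 41 * (K + M)
      linear = ≤-trans
        (≤-reflexive (trans (ℕ→ℚ-+ (33 ℕ.* a) (4 ℕ.* 2 ℕ.^ ℓ)) (cong₂ _+_ (ℕ→ℚ-* 33 a)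
          (trans (ℕ→ℚ-* 4 (2 ℕ.^ ℓ)) (cong (ℕ→ℚ 4 *_) (sym (pow-def ℓ)))))))
        (≤-trans (+-mono-≤ (*-monoˡ-≤ (ℕ→ℚ-nonNeg 33) a≤) (*-monoˡ-≤ (ℕ→ℚ-nonNeg 4) X≤))
          (≤-reflexive (eq (K + M))))
        where
        eq : ∀ x → ℕ→ℚ 33 * x + ℕ→ℚ 4 * (x + x) ≡ ℕ→ℚ 41 * x
        eq = solve-∀ ℚ-ring
      size : ℕ→ℚ ∣ stored (suc a′) ℓ ∣ ≤ ℕ→ℚ 41 * (K + M) * polylog n 3
      size = ≤-trans
        (ℕ→ℚ-mono-≤ {∣ T ∣} {(33 ℕ.* a ℕ.+ 4 ℕ.* 2 ℕ.^ ℓ) ℕ.* (P ℕ.* (P ℕ.* P))}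
          (stored-size-polylog {P} (proj₂ (proj₂ ℓ-spec)) (ℕ.s≤s ℕ.z≤n)))
        (≤-trans (≤-reflexive (ℕ→ℚ-* (33 ℕ.* a ℕ.+ 4 ℕ.* 2 ℕ.^ ℓ) (P ℕ.* (P ℕ.* P))))
        (≤-trans (*-monoʳ-≤ (ℕ→ℚ-nonNeg (P ℕ.* (P ℕ.* P))) linear)
        (≤-reflexive (cong (ℕ→ℚ 41 * (K + M) *_) P³≡polylog))))

    summary-succeeds : Succeeds summary
    summary-succeeds = choose-succeeds (ℕ→ℚ n ≤? K + M) (1ℚ ≤? K)

    output-spec : ∀ E → ArgMax f (FeasibleIn (summary ∩ ∁ E)) (output E)
    output-spec E = argMax-spec f (feasibleIn? (summary ∩ ∁ E)) (⊥ , ⊥⊆ , cost-⊥≤ 0≤K)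

theorem10 : ∃[ C ] ∃[ d ] ∃[ α ] Σ SummaryAlg λ summ → Σ OutputAlg λ out →
    (n : ℕ) (f : Subset n → ℚ) (c : Fin n → ℚ) (K M : ℚ) (m : ℕ) →
    NonNeg f → Monotone f → Submodular f → CostsAtLeastOne c →
    0ℚ ≤ K → 0ℚ ≤ M →
    (ℕ→ℚ ∣ summ n f c K M m ∣ ≤ ℕ→ℚ C * (K + M) * polylog n d)
    × ((E : Subset n) → ∣ E ∣ Data.Nat.≤ m → cost c E ≤ M →
    let Z = out n f c K M m E in
    (Z ⊆ summ n f c K M m ∩ ∁ E)
    × (cost c Z ≤ K)
    × ((S : Subset n) → S ⊆ ∁ E → cost c S ≤ K →
    f S ≤ ℕ→ℚ (suc α) * f Z))
-- The exponent 3 counts the scales, the levels of each scale, and the factor `ℓ + 1` in the number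
-- of buckets.
theorem10 = 41 , 3 , 119
  , (λ n f c K M m → Summary.summary f c K M)
  , (λ n f c K M m → Summary.output f c K M)
  , λ n f c K M m f-nonNeg f-mono f-sub 1≤c 0≤K 0≤M →
    let open Summary f c K M
        (size , approximates) = summary-succeeds f-nonNeg f-mono f-sub 1≤c 0≤K 0≤M
    in size , λ E _ E≤M →
       let ((Z⊆ , Z≤K) , Z-best) = output-spec f-nonNeg f-mono f-sub 1≤c 0≤K 0≤M E
       in Z⊆ , Z≤K , approximates E≤M Z-best
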